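{- For every proof term $M$ of $\mathbf{IPC}$, $M^\bullet\to^*_{\varrho\rho}M^\circ$ in $\mathbf{F}$; additionally, this reduction is fine in $\Gamma^\bullet$ if $M$ is typable in $\Gamma$. Hence, if $M$ is typable in $\Gamma$, then $M^\circ$ is the atomic normal form of $M^\bullet$ in $\Gamma^\bullet$ ($=\Gamma^\circ$), i.e. $M^\circ$ is the unique fine $\varrho\rho$-normal form in $\Gamma^\bullet$ to which $M^\bullet$ reduces by a $\varrho\rho$-reduction fine in $\Gamma^\bullet$.
   Context: **$\mathbf{IPC}$.** Types: $A,B,C::=X\mid\perp\mid A\supset B\mid A\wedge B\mid A\vee B$. Proof terms (raw, up to $\alpha$-equivalence): $x$, $\lambda x^A.M$, $MN$, $\langle M,N\rangle$, $M1$, $M2$ (projections), $\mathsf{in}_1(M,A,B)$, $\mathsf{in}_2(N,A,B)$, $\mathsf{case}(M,x^A.P,y^B.Q,C)$, $\mathsf{abort}(M,A)$. Typing is the usual natural deduction typing; $\mathsf{in}_i(M,A_1,A_2):A_1\vee A_2$ if $M:A_i$; $\Gamma\vdash\mathsf{case}(M,x^A.P,y^B.Q,C):C$ if $\Gamma\vdash M:A\vee B$, $\Gamma,x:A\vdash P:C$, $\Gamma,y:B\vdash Q:C$; $\mathsf{abort}(M,A):A$ if $M:\perp$. **System $\mathbf{F}$** (Church style, primitive conjunction). Types: $A,B::=X\mid A\supset B\mid A\wedge B\mid\forall X.A$. Terms (raw, not assumed typable, up to $\alpha$-equivalence): $x$, $\lambda x^A.M$, $MN$, $\langle M,N\rangle$,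 $M1$, $M2$, $\Lambda X.M$, $MB$ ($B$ a type). Application associates to the left; $\langle P_i\rangle_{i=1,2}$ is $\langle P_1,P_2\rangle$. Environments $\Gamma$ are sets of declarations $x:A$, each variable declared at most once. Typing: usual rules for $\supset,\wedge$; $\forall I$: from $\Gamma\vdash M:A$ infer $\Gamma\vdash\Lambda X.M:\forall X.A$ if $X$ is free in no type of $\Gamma$; $\forall E$: from $\Gamma\vdash M:\forall X.A$ infer $\Gamma\vdash MB:[B/X]A$. "$M$ has type $A$ in $\Gamma$" means $\Gamma\vdash M:A$ is derivable; "typable in $\Gamma$" means it has some type in $\Gamma$. Abbreviations: $A\,\underline{\vee}\,B:=\forall X.((A\supset X)\wedge(B\supset X))\supset X$ ($X$ not free in $A,B$), $\underline{\perp}:=\forall X.X$. $\mathbf{F}_{\mathbf{at}}$ is the fragment of $\mathbf{F}$ with the same types and with only those terms in which every universal instantiation $MB$ has $B$ a type variable. **Atomization conversions** (bound variables of the contractum chosen fresh). $\varrho$: $M(C_1\supset C_2)\langle\lambda x^A.P,\lambda y^B.Q\rangle\to\lambda z^{C_1}.MC_2\langle\lambda x^A.Pz,\lambda y^B.Qz\rangle$; $M(C_1\wedge C_2)\langle\lambda x^A.P,\lambda y^B.Q\rangle\to\langle MC_i\langle\lambda x^A.Pi,\lambda y^B.Qi\rangle\rangle_{i=1,2}$; $M(\forall Y.D)\langle\lambda x^A.P,\lambda y^B.Q\rangle\to\Lambda Y.MD\langle\lambda x^A.PY,\lambda y^B.QY\rangle$. $\rho$: $M(C_1\supset C_2)\to\lambda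 z^{C_1}.MC_2$; $M(C_1\wedge C_2)\to\langle MC_i\rangle_{i=1,2}$; $M(\forall Y.D)\to\Lambda Y.MD$. $\to_{\varrho\rho}$ is the compatible closure of $\varrho\cup\rho$, and $\to^*_{\varrho\rho}$ its reflexive-transitive closure. **Fineness.** A root $\varrho$-reduction as displayed is fine in $\Gamma$ if $M$ has type $A\,\underline{\vee}\,B$ in $\Gamma$; a root $\rho$-reduction is fine in $\Gamma$ if $M$ has type $\underline{\perp}$ in $\Gamma$. "$M\to_{\varrho\rho}M'$ is fine in $\Gamma$" is the ternary relation inductively generated from the fine root reductions by: if $M\to M'$ is fine in $x:A,\Gamma$ then $\lambda x^A.M\to\lambda x^A.M'$ is fine in $\Gamma$; and, if $M\to M'$ is fine in $\Gamma$, then so are $MN\to M'N$, $NM\to NM'$, $\langle M,N\rangle\to\langle M',N\rangle$, $\langle N,M\rangle\to\langle N,M'\rangle$, $Mi\to M'i$, $\Lambda X.M\to\Lambda X.M'$, $MB\to M'B$. "$M\to_{\varrho\rho}^*M'$ is fine in $\Gamma$" is the reflexive-transitive closure for fixed $\Gamma$. $M$ is a fine $\varrho\rho$-normal form in $\Gamma$ if $M\to_{\varrho\rho}M'$ is fine in $\Gamma$ for no $M'$. **Translations of $\mathbf{IPC}$.** On types, $A^\circ=A^\bullet$ with $X^\bullet=X$, $\perp^\bullet=\underline{\perp}$, $(A\supset B)^\bullet=A^\bullet\supset B^\bullet$, $(A\wedge B)^\bullet=A^\bullet\wedge B^\bullet$, $(A\vee B)^\bullet=A^\bullet\,\underline{\vee}\,B^\bullet$;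 $\Gamma^\bullet$ translates all types in $\Gamma$. On terms both maps are homomorphic on variables, $\lambda$ (translating the annotation), application, pairs and projections. Russell-Prawitz map into $\mathbf{F}$: $(\mathsf{in}_i(M,A,B))^\bullet=\Lambda X.\lambda w^{(A^\bullet\supset X)\wedge(B^\bullet\supset X)}.(w\,i)M^\bullet$ ($X$, $w$ fresh), $(\mathsf{case}(M,x^A.P,y^B.Q,C))^\bullet=M^\bullet C^\bullet\langle\lambda x^{A^\bullet}.P^\bullet,\lambda y^{B^\bullet}.Q^\bullet\rangle$, $(\mathsf{abort}(M,A))^\bullet=M^\bullet A^\bullet$. Map into $\mathbf{F}_{\mathbf{at}}$: $(\mathsf{in}_i(M,A,B))^\circ=\Lambda X.\lambda w^{(A^\circ\supset X)\wedge(B^\circ\supset X)}.(w\,i)M^\circ$, $(\mathsf{case}(M,x^A.P,y^B.Q,C))^\circ=\underline{\mathtt{case}}(M^\circ,x^{A^\circ}.P^\circ,y^{B^\circ}.Q^\circ,C^\circ)$, $(\mathsf{abort}(M,A))^\circ=\underline{\mathtt{abort}}(M^\circ,A^\circ)$, where (bound variables $z$, $X$ fresh) $\underline{\mathtt{case}}$ is defined by recursion on its last argument: $\underline{\mathtt{case}}(M,x^A.P,y^B.Q,X)=MX\langle\lambda x^A.P,\lambda y^B.Q\rangle$; $\underline{\mathtt{case}}(M,x^A.P,y^B.Q,C_1\wedge C_2)=\langle\underline{\mathtt{case}}(M,x^A.Pi,y^B.Qi,C_i)\rangle_{i=1,2}$; $\underline{\mathtt{case}}(M,x^A.P,y^B.Q,C\supset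 D)=\lambda z^C.\underline{\mathtt{case}}(M,x^A.Pz,y^B.Qz,D)$; $\underline{\mathtt{case}}(M,x^A.P,y^B.Q,\forall X.C)=\Lambda X.\underline{\mathtt{case}}(M,x^A.PX,y^B.QX,C)$; and $\underline{\mathtt{abort}}(M,X)=MX$, $\underline{\mathtt{abort}}(M,A_1\wedge A_2)=\langle\underline{\mathtt{abort}}(M,A_1),\underline{\mathtt{abort}}(M,A_2)\rangle$, $\underline{\mathtt{abort}}(M,B\supset C)=\lambda z^B.\underline{\mathtt{abort}}(M,C)$, $\underline{\mathtt{abort}}(M,\forall X.A)=\Lambda X.\underline{\mathtt{abort}}(M,A)$. -}

module Defs where

open import Data.Fin.Base using (Fin; zero; suc)
open import Data.Fin.Substitution using (Sub; Lift; TermSubst; module VarSubst)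
open import Data.Nat.Base using (ℕ; suc)
open import Data.Product.Base using (∃; _×_)
open import Data.Vec.Base using (Vec; _∷_; map; lookup)
open import Relation.Binary.Construct.Closure.ReflexiveTransitive using (Star)
open import Relation.Binary.PropositionalEquality using (_≡_)
open import Relation.Nullary.Negation using (¬_)

private
  variable
    m m′ n n′ : ℕ

-- Terms up to α-equivalence are represented by well-scoped de Bruijn terms:
-- m counts the type variables in scope and n the term variables.  Terms are
-- raw: nothing is assumed about their typability.  An environment declares a
-- type for each of the n term variables in scope.

module IPC where

  infixr 6 _⊃_
  infixr 7 _∨_
  infixr 8 _∧_
  infixl 9 _·_
  infix  9 _·₁ _·₂
  infix  10 `_
  infix  4 _⊢_∶_

  data Ty (m : ℕ) : Set where
    var : Fin m → Ty m
    ⊥   : Ty m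
    _⊃_ : Ty m → Ty m → Ty m
    _∧_ : Ty m → Ty m → Ty m
    _∨_ : Ty m → Ty m → Ty m

  data Tm (m n : ℕ) : Set where
    `_    : Fin n → Tm m n
    ƛ     : Ty m → Tm m (suc n) → Tm m n
    _·_   : Tm m n → Tm m n → Tm m n
    ⟨_,_⟩ : Tm m n → Tm m n → Tm m n
    _·₁   : Tm m n → Tm m n
    _·₂   : Tm m n → Tm m n
    in₁   : Tm m n → Ty m → Ty m → Tm m n
    in₂   : Tm m n → Ty m → Ty m → Tm m n
    case  : Tm m n → Ty m → Tm m (suc n) → Ty m → Tm m (suc n) → Ty m → Tm m n
    abort : Tm m n → Ty m → Tm m n

  Ctx : ℕ → ℕ → Set
  Ctx m n = Vec (Ty m) n

  data _⊢_∶_ (Γ : Ctx m n) : Tm m n → Ty m → Set where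
    ax : ∀ x → Γ ⊢ ` x ∶ lookup Γ x
    ⊃I : ∀ {A B M} → A ∷ Γ ⊢ M ∶ B → Γ ⊢ ƛ A M ∶ A ⊃ B
    ⊃E : ∀ {A B M N} → Γ ⊢ M ∶ A ⊃ B → Γ ⊢ N ∶ A → Γ ⊢ M · N ∶ B
    ∧I : ∀ {A B M N} → Γ ⊢ M ∶ A → Γ ⊢ N ∶ B → Γ ⊢ ⟨ M , N ⟩ ∶ A ∧ B
    ∧E₁ : ∀ {A B M} → Γ ⊢ M ∶ A ∧ B → Γ ⊢ M ·₁ ∶ A
    ∧E₂ : ∀ {A B M} → Γ ⊢ M ∶ A ∧ B → Γ ⊢ M ·₂ ∶ B
    ∨I₁ : ∀ {A B M} → Γ ⊢ M ∶ A → Γ ⊢ in₁ M A B ∶ A ∨ B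
    ∨I₂ : ∀ {A B M} → Γ ⊢ M ∶ B → Γ ⊢ in₂ M A B ∶ A ∨ B
    ∨E : ∀ {A B C M P Q} → Γ ⊢ M ∶ A ∨ B → A ∷ Γ ⊢ P ∶ C → B ∷ Γ ⊢ Q ∶ C →
         Γ ⊢ case M A P B Q C ∶ C
    ⊥E : ∀ {A M} → Γ ⊢ M ∶ ⊥ → Γ ⊢ abort M A ∶ A

  Typable : Ctx m n → Tm m n → Set
  Typable Γ M = ∃ λ A → Γ ⊢ M ∶ A

module F where

  infixr 6 _⊃_
  infixr 7 _⊻_
  infixr 8 _∧_
  infixl 9 _·_ _·ᵗ_
  infix  9 _·₁ _·₂
  infix  10 `_ _⇑ _⇑₁ _⇑ᵗ _⇑ᶜ
  infix  4 _⊢_∶_ _⟶_ _⟶*_ _⊢_⟶_fine _⊢_⟶*_fine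

  data Ty (m : ℕ) : Set where
    var : Fin m → Ty m
    _⊃_ : Ty m → Ty m → Ty m
    _∧_ : Ty m → Ty m → Ty m
    ∀̇   : Ty (suc m) → Ty m

  module TyApp {T : ℕ → Set} (l : Lift T Ty) where
    open Lift l using (lift; _↑)

    infixl 8 _/_

    _/_ : Ty m → Sub T m m′ → Ty m′
    var X   / σ = lift (lookup σ X)
    (A ⊃ B) / σ = (A / σ) ⊃ (B / σ)
    (A ∧ B) / σ = (A / σ) ∧ (B / σ)
    ∀̇ A     / σ = ∀̇ (A / σ ↑)

  tySubst : TermSubst Ty
  tySubst = record { var = var ; app = TyApp._/_ }

  open TermSubst tySubst public using (_/_; _/Var_; weaken; sub)

  -- (A ⊃ X) ∧ (B ⊃ X), in the scope of the binder of X.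
  elimTy : Ty m → Ty m → Ty (suc m)
  elimTy A B = (weaken A ⊃ var zero) ∧ (weaken B ⊃ var zero)

  _⊻_ : Ty m → Ty m → Ty m
  A ⊻ B = ∀̇ (elimTy A B ⊃ var zero)

  ⊥̲ : Ty m
  ⊥̲ = ∀̇ (var zero)

  data Tm (m n : ℕ) : Set where
    `_    : Fin n → Tm m n
    ƛ     : Ty m → Tm m (suc n) → Tm m n
    _·_   : Tm m n → Tm m n → Tm m n
    ⟨_,_⟩ : Tm m n → Tm m n → Tm m n
    _·₁   : Tm m n → Tm m n
    _·₂   : Tm m n → Tm m n
    Λ     : Tm (suc m) n → Tm m n
    _·ᵗ_  : Tm m n → Ty m → Tm m n

  rename : Sub Fin m m′ → Sub Fin n n′ → Tm m n → Tm m′ n′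
  rename ρ σ (` x)     = ` lookup σ x
  rename ρ σ (ƛ A M)   = ƛ (A /Var ρ) (rename ρ (σ VarSubst.↑) M)
  rename ρ σ (M · N)   = rename ρ σ M · rename ρ σ N
  rename ρ σ ⟨ M , N ⟩ = ⟨ rename ρ σ M , rename ρ σ N ⟩
  rename ρ σ (M ·₁)    = rename ρ σ M ·₁
  rename ρ σ (M ·₂)    = rename ρ σ M ·₂
  rename ρ σ (Λ M)     = Λ (rename (ρ VarSubst.↑) σ M)
  rename ρ σ (M ·ᵗ B)  = rename ρ σ M ·ᵗ (B /Var ρ)

  _⇑ : Tm m n → Tm m (suc n)
  M ⇑ = rename VarSubst.id VarSubst.wk M

  -- Weakening by a fresh variable beneath the innermost binder: it becomes
  -- index 1, while index 0 stays in place.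
  _⇑₁ : Tm m (suc n) → Tm m (suc (suc n))
  M ⇑₁ = rename VarSubst.id (VarSubst.wk VarSubst.↑) M

  _⇑ᵗ : Tm m n → Tm (suc m) n
  M ⇑ᵗ = rename VarSubst.wk VarSubst.id M

  Ctx : ℕ → ℕ → Set
  Ctx m n = Vec (Ty m) n

  _⇑ᶜ : Ctx m n → Ctx (suc m) n
  Γ ⇑ᶜ = map weaken Γ

  -- The context Γ ⇑ᶜ expresses that the variable bound by Λ is free in no
  -- type of Γ.
  data _⊢_∶_ (Γ : Ctx m n) : Tm m n → Ty m → Set where
    ax : ∀ x → Γ ⊢ ` x ∶ lookup Γ x
    ⊃I : ∀ {A B M} → A ∷ Γ ⊢ M ∶ B → Γ ⊢ ƛ A M ∶ A ⊃ B
    ⊃E : ∀ {A B M N} → Γ ⊢ M ∶ A ⊃ B → Γ ⊢ N ∶ A → Γ ⊢ M · N ∶ B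
    ∧I : ∀ {A B M N} → Γ ⊢ M ∶ A → Γ ⊢ N ∶ B → Γ ⊢ ⟨ M , N ⟩ ∶ A ∧ B
    ∧E₁ : ∀ {A B M} → Γ ⊢ M ∶ A ∧ B → Γ ⊢ M ·₁ ∶ A
    ∧E₂ : ∀ {A B M} → Γ ⊢ M ∶ A ∧ B → Γ ⊢ M ·₂ ∶ B
    ∀I : ∀ {A M} → Γ ⇑ᶜ ⊢ M ∶ A → Γ ⊢ Λ M ∶ ∀̇ A
    ∀E : ∀ {A M} B → Γ ⊢ M ∶ ∀̇ A → Γ ⊢ M ·ᵗ B ∶ A / sub B

  -- The root conversions are indexed by the data on which fineness depends:
  -- the head M and, for ϱ, the annotations A and B.

  data ϱ-root (M : Tm m n) (A B : Ty m) : Tm m n → Tm m n → Set where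
    ϱ-⊃ : ∀ {C₁ C₂ P Q} →
      ϱ-root M A B
        (M ·ᵗ (C₁ ⊃ C₂) · ⟨ ƛ A P , ƛ B Q ⟩)
        (ƛ C₁ (M ⇑ ·ᵗ C₂ · ⟨ ƛ A (P ⇑₁ · ` suc zero) , ƛ B (Q ⇑₁ · ` suc zero) ⟩))
    ϱ-∧ : ∀ {C₁ C₂ P Q} →
      ϱ-root M A B
        (M ·ᵗ (C₁ ∧ C₂) · ⟨ ƛ A P , ƛ B Q ⟩)
        ⟨ M ·ᵗ C₁ · ⟨ ƛ A (P ·₁) , ƛ B (Q ·₁) ⟩
        , M ·ᵗ C₂ · ⟨ ƛ A (P ·₂) , ƛ B (Q ·₂) ⟩ ⟩
    ϱ-∀ : ∀ {D P Q} →
      ϱ-root M A B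
        (M ·ᵗ ∀̇ D · ⟨ ƛ A P , ƛ B Q ⟩)
        (Λ (M ⇑ᵗ ·ᵗ D · ⟨ ƛ (weaken A) (P ⇑ᵗ ·ᵗ var zero)
                        , ƛ (weaken B) (Q ⇑ᵗ ·ᵗ var zero) ⟩))

  data ρ-root (M : Tm m n) : Tm m n → Tm m n → Set where
    ρ-⊃ : ∀ {C₁ C₂} → ρ-root M (M ·ᵗ (C₁ ⊃ C₂)) (ƛ C₁ (M ⇑ ·ᵗ C₂))
    ρ-∧ : ∀ {C₁ C₂} → ρ-root M (M ·ᵗ (C₁ ∧ C₂)) ⟨ M ·ᵗ C₁ , M ·ᵗ C₂ ⟩
    ρ-∀ : ∀ {D} → ρ-root M (M ·ᵗ ∀̇ D) (Λ (M ⇑ᵗ ·ᵗ D))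

  data _⟶_ {m n} : Tm m n → Tm m n → Set where
    ϱ   : ∀ {M A B N N′} → ϱ-root M A B N N′ → N ⟶ N′
    ρ   : ∀ {M N N′} → ρ-root M N N′ → N ⟶ N′
    ξ-ƛ : ∀ {A M M′} → M ⟶ M′ → ƛ A M ⟶ ƛ A M′
    ξ-·ˡ : ∀ {M M′ N} → M ⟶ M′ → M · N ⟶ M′ · N
    ξ-·ʳ : ∀ {M M′ N} → M ⟶ M′ → N · M ⟶ N · M′
    ξ-⟨⟩ˡ : ∀ {M M′ N} → M ⟶ M′ → ⟨ M , N ⟩ ⟶ ⟨ M′ , N ⟩
    ξ-⟨⟩ʳ : ∀ {M M′ N} → M ⟶ M′ → ⟨ N , M ⟩ ⟶ ⟨ N , M′ ⟩
    ξ-·₁ : ∀ {M M′} → M ⟶ M′ → M ·₁ ⟶ M′ ·₁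
    ξ-·₂ : ∀ {M M′} → M ⟶ M′ → M ·₂ ⟶ M′ ·₂
    ξ-Λ : ∀ {M M′} → M ⟶ M′ → Λ M ⟶ Λ M′
    ξ-·ᵗ : ∀ {M M′ B} → M ⟶ M′ → M ·ᵗ B ⟶ M′ ·ᵗ B

  _⟶*_ : Tm m n → Tm m n → Set
  _⟶*_ = Star _⟶_

  data _⊢_⟶_fine {m n} (Γ : Ctx m n) : Tm m n → Tm m n → Set where
    ϱ   : ∀ {M A B N N′} → Γ ⊢ M ∶ A ⊻ B → ϱ-root M A B N N′ → Γ ⊢ N ⟶ N′ fine
    ρ   : ∀ {M N N′} → Γ ⊢ M ∶ ⊥̲ → ρ-root M N N′ → Γ ⊢ N ⟶ N′ fine
    ξ-ƛ : ∀ {A M M′} → A ∷ Γ ⊢ M ⟶ M′ fine → Γ ⊢ ƛ A M ⟶ ƛ A M′ fine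
    ξ-·ˡ : ∀ {M M′ N} → Γ ⊢ M ⟶ M′ fine → Γ ⊢ M · N ⟶ M′ · N fine
    ξ-·ʳ : ∀ {M M′ N} → Γ ⊢ M ⟶ M′ fine → Γ ⊢ N · M ⟶ N · M′ fine
    ξ-⟨⟩ˡ : ∀ {M M′ N} → Γ ⊢ M ⟶ M′ fine → Γ ⊢ ⟨ M , N ⟩ ⟶ ⟨ M′ , N ⟩ fine
    ξ-⟨⟩ʳ : ∀ {M M′ N} → Γ ⊢ M ⟶ M′ fine → Γ ⊢ ⟨ N , M ⟩ ⟶ ⟨ N , M′ ⟩ fine
    ξ-·₁ : ∀ {M M′} → Γ ⊢ M ⟶ M′ fine → Γ ⊢ M ·₁ ⟶ M′ ·₁ fine
    ξ-·₂ : ∀ {M M′} → Γ ⊢ M ⟶ M′ fine → Γ ⊢ M ·₂ ⟶ M′ ·₂ fine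
    ξ-Λ : ∀ {M M′} → Γ ⇑ᶜ ⊢ M ⟶ M′ fine → Γ ⊢ Λ M ⟶ Λ M′ fine
    ξ-·ᵗ : ∀ {M M′ B} → Γ ⊢ M ⟶ M′ fine → Γ ⊢ M ·ᵗ B ⟶ M′ ·ᵗ B fine

  _⊢_⟶*_fine : Ctx m n → Tm m n → Tm m n → Set
  Γ ⊢ M ⟶* M′ fine = Star (Γ ⊢_⟶_fine) M M′

  FineNormal : Ctx m n → Tm m n → Set
  FineNormal Γ M = ∀ M′ → ¬ (Γ ⊢ M ⟶ M′ fine)

  IsFineNormalFormOf : Ctx m n → Tm m n → Tm m n → Set
  IsFineNormalFormOf Γ M N = (Γ ⊢ M ⟶* N fine) × FineNormal Γ N

  IsAtomicNormalFormOf : Ctx m n → Tm m n → Tm m n → Set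
  IsAtomicNormalFormOf Γ M N =
    IsFineNormalFormOf Γ M N × (∀ N′ → IsFineNormalFormOf Γ M N′ → N′ ≡ N)

  case̲ : Tm m n → Ty m → Tm m (suc n) → Ty m → Tm m (suc n) → Ty m → Tm m n
  case̲ M A P B Q (var X) = M ·ᵗ var X · ⟨ ƛ A P , ƛ B Q ⟩
  case̲ M A P B Q (C ⊃ D) =
    ƛ C (case̲ (M ⇑) A (P ⇑₁ · ` suc zero) B (Q ⇑₁ · ` suc zero) D)
  case̲ M A P B Q (C₁ ∧ C₂) =
    ⟨ case̲ M A (P ·₁) B (Q ·₁) C₁ , case̲ M A (P ·₂) B (Q ·₂) C₂ ⟩
  case̲ M A P B Q (∀̇ C) =
    Λ (case̲ (M ⇑ᵗ) (weaken A) (P ⇑ᵗ ·ᵗ var zero) (weaken B) (Q ⇑ᵗ ·ᵗ var zero) C)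

  abort̲ : Tm m n → Ty m → Tm m n
  abort̲ M (var X)   = M ·ᵗ var X
  abort̲ M (B ⊃ C)   = ƛ B (abort̲ (M ⇑) C)
  abort̲ M (A₁ ∧ A₂) = ⟨ abort̲ M A₁ , abort̲ M A₂ ⟩
  abort̲ M (∀̇ A)     = Λ (abort̲ (M ⇑ᵗ) A)

open F using (_⊃_; _∧_; _⊻_; ⊥̲; ƛ; Λ; _·_; _·ᵗ_; ⟨_,_⟩; _·₁; _·₂; `_; _⇑; _⇑ᵗ;
              elimTy; case̲; abort̲)

infix 11 _•ᵗ _•ᶜ _• _°

-- On types and environments the two translations coincide.

_•ᵗ : IPC.Ty m → F.Ty m
IPC.var X   •ᵗ = F.var X
IPC.⊥       •ᵗ = ⊥̲
(A IPC.⊃ B) •ᵗ = A •ᵗ ⊃ B •ᵗ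
(A IPC.∧ B) •ᵗ = A •ᵗ ∧ B •ᵗ
(A IPC.∨ B) •ᵗ = A •ᵗ ⊻ B •ᵗ

_•ᶜ : IPC.Ctx m n → F.Ctx m n
Γ •ᶜ = map _•ᵗ Γ

_• : IPC.Tm m n → F.Tm m n
(IPC.` x)            • = ` x
IPC.ƛ A M            • = ƛ (A •ᵗ) (M •)
(M IPC.· N)          • = M • · N •
IPC.⟨ M , N ⟩        • = ⟨ M • , N • ⟩
(M IPC.·₁)           • = (M •) ·₁
(M IPC.·₂)           • = (M •) ·₂
IPC.in₁ M A B        • = Λ (ƛ (elimTy (A •ᵗ) (B •ᵗ)) ((` zero) ·₁ · M • ⇑ᵗ ⇑))
IPC.in₂ M A B        • = Λ (ƛ (elimTy (A •ᵗ) (B •ᵗ)) ((` zero) ·₂ · M • ⇑ᵗ ⇑))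
IPC.case M A P B Q C • = M • ·ᵗ C •ᵗ · ⟨ ƛ (A •ᵗ) (P •) , ƛ (B •ᵗ) (Q •) ⟩
IPC.abort M A        • = M • ·ᵗ A •ᵗ

_° : IPC.Tm m n → F.Tm m n
(IPC.` x)            ° = ` x
IPC.ƛ A M            ° = ƛ (A •ᵗ) (M °)
(M IPC.· N)          ° = M ° · N °
IPC.⟨ M , N ⟩        ° = ⟨ M ° , N ° ⟩
(M IPC.·₁)           ° = (M °) ·₁
(M IPC.·₂)           ° = (M °) ·₂
IPC.in₁ M A B        ° = Λ (ƛ (elimTy (A •ᵗ) (B •ᵗ)) ((` zero) ·₁ · M ° ⇑ᵗ ⇑))
IPC.in₂ M A B        ° = Λ (ƛ (elimTy (A •ᵗ) (B •ᵗ)) ((` zero) ·₂ · M ° ⇑ᵗ ⇑))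
IPC.case M A P B Q C ° = case̲ (M °) (A •ᵗ) (P °) (B •ᵗ) (Q °) (C •ᵗ)
IPC.abort M A        ° = abort̲ (M °) (A •ᵗ)

{-# OPTIONS --safe #-}

-- The reduction M • ⟶* M ° first reduces the subterms and then unfolds the
-- instantiation at the root; the unfolded step is fine because fine reduction
-- preserves types.  M ° is fine-normal since it instantiates at variables only.
--
-- Uniqueness does not go through confluence.  A function nf replaces, bottom-up,
-- each fine redex K C ⟨λx.P, λy.Q⟩ or K C by the complete unfolding case̲ or
-- abort̲.  It is invariant under fine reduction and is the identity on typable
-- fine normal forms, so any fine normal form N of M is nf N = nf M.

module Submission where

open import Data.Fin.Base using (Fin; zero; suc)
import Data.Fin.Properties as Fin
open import Data.Fin.Substitution using (Sub; Subs; Lift; TermSubst; module VarSubst)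
open import Data.Fin.Substitution.Lemmas using (TermLemmas; module VarLemmas)
open import Data.Maybe.Base using (Maybe; just; nothing)
open import Data.Nat.Base using (ℕ; suc)
open import Data.Product.Base using (_×_; _,_; uncurry)
open import Data.Vec.Base using (_∷_; map; lookup)
open import Data.Vec.Properties using (lookup-map)
open import Function.Base using (_∘_)
open import Function.Definitions using (Injective)
open import Relation.Binary.Construct.Closure.ReflexiveTransitive
  using (ε; _◅_; _◅◅_; gmap)
open import Relation.Binary.PropositionalEquality
  using (_≡_; _≢_; refl; sym; trans; cong; cong₂; subst; subst₂; module ≡-Reasoning)
open import Relation.Nullary using (Dec; yes; no; ¬_; contradiction)
open import Relation.Nullary.Decidable using (map′; _×-dec_)
open import Defs
open F hiding (ρ)

private
  module V = VarSubst
  variable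
    m m′ n n′ : ℕ

-- Fineness refers to typing, whereas steps act on raw terms whose other parts may be untypable. The
-- function `nf` therefore tests heads with `tyOf`, a total function that returns the type of every
-- typable term. Derivations come back in only where such a test must be turned into a fine step,
-- that is, on normal forms. The recursion of `nf` is structural in the term and that of `case̲` and
-- `abort̲` in the type, so termination of reduction never enters. Invariance comes down to one
-- equation per root conversion. A ϱ-contractum wraps each branch in an application to a term
-- variable, a projection or an instantiation at a type variable, and none of these forms a new
-- redex. Hence normalising the contractum yields exactly one unfolded clause of `case̲`. The
-- contractum also weakens its head and branches, which is why `nf` must commute with renaming; most
-- of the infrastructure serves that single fact.

⊃-injective : {A A′ B B′ : Ty m} → A ⊃ B ≡ A′ ⊃ B′ → A ≡ A′ × B ≡ B′
⊃-injective refl = refl , refl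

∧-injective : {A A′ B B′ : Ty m} → A ∧ B ≡ A′ ∧ B′ → A ≡ A′ × B ≡ B′
∧-injective refl = refl , refl

∀̇-injective : {A B : Ty (suc m)} → ∀̇ A ≡ ∀̇ B → A ≡ B
∀̇-injective refl = refl

var-injective : {X Y : Fin m} → Ty.var X ≡ var Y → X ≡ Y
var-injective refl = refl

infix 4 _≟_

-- Serves the two tests made by `nf`: whether a head has type `⊥̲`, and whether its type is `A ⊻ B`
-- for the very annotations `A` and `B` of the branches.
_≟_ : (A B : Ty m) → Dec (A ≡ B)
var X   ≟ var Y     = map′ (cong var) var-injective (X Fin.≟ Y)
var _   ≟ (_ ⊃ _)   = no λ ()
var _   ≟ (_ ∧ _)   = no λ ()
var _   ≟ ∀̇ _       = no λ ()
(_ ⊃ _) ≟ var _     = no λ ()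
(A ⊃ B) ≟ (A′ ⊃ B′) = map′ (uncurry (cong₂ _⊃_)) ⊃-injective (A ≟ A′ ×-dec B ≟ B′)
(_ ⊃ _) ≟ (_ ∧ _)   = no λ ()
(_ ⊃ _) ≟ ∀̇ _       = no λ ()
(_ ∧ _) ≟ var _     = no λ ()
(_ ∧ _) ≟ (_ ⊃ _)   = no λ ()
(A ∧ B) ≟ (A′ ∧ B′) = map′ (uncurry (cong₂ _∧_)) ∧-injective (A ≟ A′ ×-dec B ≟ B′)
(_ ∧ _) ≟ ∀̇ _       = no λ ()
∀̇ _     ≟ var _     = no λ ()
∀̇ _     ≟ (_ ⊃ _)   = no λ ()
∀̇ _     ≟ (_ ∧ _)   = no λ ()
∀̇ A     ≟ ∀̇ B       = map′ (cong ∀̇) ∀̇-injective (A ≟ B)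

-- Renaming and substitution in types

module TyLemmas where

  module _ {T : ℕ → Set} {l : Lift T Ty} where
    open TermSubst.Lifted tySubst l using (_↑✶_; _/✶_)

    ⊃-/✶-↑✶ : ∀ k {m n A B} (σs : Subs T m n) →
              (A ⊃ B) /✶ σs ↑✶ k ≡ (A /✶ σs ↑✶ k) ⊃ (B /✶ σs ↑✶ k)
    ⊃-/✶-↑✶ k ε        = refl
    ⊃-/✶-↑✶ k (σ ◅ σs) = cong₂ (TermSubst.app tySubst l) (⊃-/✶-↑✶ k σs) refl

    ∧-/✶-↑✶ : ∀ k {m n A B} (σs : Subs T m n) →
              (A ∧ B) /✶ σs ↑✶ k ≡ (A /✶ σs ↑✶ k) ∧ (B /✶ σs ↑✶ k)
    ∧-/✶-↑✶ k ε        = refl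
    ∧-/✶-↑✶ k (σ ◅ σs) = cong₂ (TermSubst.app tySubst l) (∧-/✶-↑✶ k σs) refl

    ∀-/✶-↑✶ : ∀ k {m n A} (σs : Subs T m n) →
              ∀̇ A /✶ σs ↑✶ k ≡ ∀̇ (A /✶ σs ↑✶ suc k)
    ∀-/✶-↑✶ k ε        = refl
    ∀-/✶-↑✶ k (σ ◅ σs) = cong₂ (TermSubst.app tySubst l) (∀-/✶-↑✶ k σs) refl

  module _ {T₁ T₂ : ℕ → Set} {l₁ : Lift T₁ Ty} {l₂ : Lift T₂ Ty} where
    open TermSubst.Lifted tySubst l₁ using () renaming (_↑✶_ to _↑✶₁_; _/✶_ to _/✶₁_)
    open TermSubst.Lifted tySubst l₂ using () renaming (_↑✶_ to _↑✶₂_; _/✶_ to _/✶₂_)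

    -- The depth `k` lets the induction pass under `∀̇`, where the sequences are lifted once more.
    -- With this, the generic substitution lemmas apply to types.
    /✶-↑✶ : ∀ {m n} (ρs₁ : Subs T₁ m n) (ρs₂ : Subs T₂ m n) →
            (∀ k x → var x /✶₁ ρs₁ ↑✶₁ k ≡ var x /✶₂ ρs₂ ↑✶₂ k) →
            ∀ k A → A /✶₁ ρs₁ ↑✶₁ k ≡ A /✶₂ ρs₂ ↑✶₂ k
    /✶-↑✶ ρs₁ ρs₂ hyp k (var X) = hyp k X
    /✶-↑✶ ρs₁ ρs₂ hyp k (A ⊃ B) = begin
      (A ⊃ B) /✶₁ ρs₁ ↑✶₁ k                       ≡⟨ ⊃-/✶-↑✶ k ρs₁ ⟩
      (A /✶₁ ρs₁ ↑✶₁ k) ⊃ (B /✶₁ ρs₁ ↑✶₁ k)       ≡⟨ cong₂ _⊃_ (/✶-↑✶ ρs₁ ρs₂ hyp k A) (/✶-↑✶ ρs₁ ρs₂ hyp k B) ⟩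
      (A /✶₂ ρs₂ ↑✶₂ k) ⊃ (B /✶₂ ρs₂ ↑✶₂ k)       ≡⟨ ⊃-/✶-↑✶ k ρs₂ ⟨
      (A ⊃ B) /✶₂ ρs₂ ↑✶₂ k                       ∎
      where open ≡-Reasoning
    /✶-↑✶ ρs₁ ρs₂ hyp k (A ∧ B) = begin
      (A ∧ B) /✶₁ ρs₁ ↑✶₁ k                       ≡⟨ ∧-/✶-↑✶ k ρs₁ ⟩
      (A /✶₁ ρs₁ ↑✶₁ k) ∧ (B /✶₁ ρs₁ ↑✶₁ k)       ≡⟨ cong₂ _∧_ (/✶-↑✶ ρs₁ ρs₂ hyp k A) (/✶-↑✶ ρs₁ ρs₂ hyp k B) ⟩
      (A /✶₂ ρs₂ ↑✶₂ k) ∧ (B /✶₂ ρs₂ ↑✶₂ k)       ≡⟨ ∧-/✶-↑✶ k ρs₂ ⟨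
      (A ∧ B) /✶₂ ρs₂ ↑✶₂ k                       ∎
      where open ≡-Reasoning
    /✶-↑✶ ρs₁ ρs₂ hyp k (∀̇ A) = begin
      ∀̇ A /✶₁ ρs₁ ↑✶₁ k                           ≡⟨ ∀-/✶-↑✶ k ρs₁ ⟩
      ∀̇ (A /✶₁ ρs₁ ↑✶₁ suc k)                     ≡⟨ cong ∀̇ (/✶-↑✶ ρs₁ ρs₂ hyp (suc k) A) ⟩
      ∀̇ (A /✶₂ ρs₂ ↑✶₂ suc k)                     ≡⟨ ∀-/✶-↑✶ k ρs₂ ⟨
      ∀̇ A /✶₂ ρs₂ ↑✶₂ k                           ∎
      where open ≡-Reasoning

  tyLemmas : TermLemmas Ty
  tyLemmas = record { termSubst = tySubst ; app-var = refl ; /✶-↑✶ = /✶-↑✶ }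

  open TermLemmas tyLemmas public
    using (weaken-sub; sub-commutes-with-renaming; /Var≡/; sub≡sub)

open TyLemmas

/Var-id : (A : Ty m) → A /Var V.id ≡ A
/Var-id (var X) = cong var (VarLemmas.lookup-id X)
/Var-id (A ⊃ B) = cong₂ _⊃_ (/Var-id A) (/Var-id B)
/Var-id (A ∧ B) = cong₂ _∧_ (/Var-id A) (/Var-id B)
/Var-id (∀̇ A)   = cong ∀̇ (/Var-id A)

/Var-⊙ : ∀ {k} (A : Ty m) {ρ₁ : Sub Fin m n} {ρ₂ : Sub Fin n k} →
         A /Var ρ₁ /Var ρ₂ ≡ A /Var (ρ₁ V.⊙ ρ₂)
/Var-⊙ (var X) {ρ₁} {ρ₂} = cong var (sym (VarLemmas.lookup-⊙ X {ρ₁ = ρ₁} {ρ₂}))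
/Var-⊙ (A ⊃ B) = cong₂ _⊃_ (/Var-⊙ A) (/Var-⊙ B)
/Var-⊙ (A ∧ B) = cong₂ _∧_ (/Var-⊙ A) (/Var-⊙ B)
/Var-⊙ (∀̇ A)   = cong ∀̇ (trans (/Var-⊙ A) (cong (A /Var_) (sym (VarLemmas.↑⋆-distrib 1))))

weaken-/Var : (A : Ty m) {ρ : Sub Fin m n} → weaken A /Var (ρ V.↑) ≡ weaken (A /Var ρ)
weaken-/Var A = trans (/Var-⊙ A) (trans (cong (A /Var_) (sym VarLemmas.⊙-wk)) (sym (/Var-⊙ A)))

⊻-/Var : (A B : Ty m) {ρ : Sub Fin m n} → (A ⊻ B) /Var ρ ≡ (A /Var ρ) ⊻ (B /Var ρ)
⊻-/Var A B = cong₂ (λ A′ B′ → ∀̇ ((A′ ⊃ var zero) ∧ (B′ ⊃ var zero) ⊃ var zero))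
                   (weaken-/Var A) (weaken-/Var B)

-- The type-level side of expanding a term of type `∀̇ A`: weakening keeps the bound variable at
-- index 0 and makes room beneath it, and instantiating at the fresh variable closes that gap again.
wk↑-sub-zero : (A : Ty (suc m)) → A /Var (V.wk V.↑) / sub (var zero) ≡ A
wk↑-sub-zero A = begin
  A /Var (V.wk V.↑) / sub (var zero)      ≡⟨ cong (A /Var (V.wk V.↑) /_) sub≡sub ⟨
  A /Var (V.wk V.↑) / map var (V.sub zero) ≡⟨ /Var≡/ {t = A /Var (V.wk V.↑)} ⟨
  A /Var (V.wk V.↑) /Var V.sub zero       ≡⟨ /Var-⊙ A ⟩
  -- The head of the composition computes to `zero`; the lemma cancels the rest to `wk`, and
  -- `zero ∷ wk` is the identity by definition.
  A /Var (V.wk V.↑ V.⊙ V.sub zero)        ≡⟨ cong (λ ρ → A /Var (zero ∷ ρ)) VarLemmas.map-weaken-⊙-sub ⟩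
  A /Var V.id                             ≡⟨ /Var-id A ⟩
  A                                       ∎
  where open ≡-Reasoning

-- Injective renamings

Inj : Sub Fin m n → Set
Inj ρ = Injective _≡_ _≡_ (lookup ρ)

↑-injective : {ρ : Sub Fin m n} → Inj ρ → Inj (ρ V.↑)
↑-injective {ρ = ρ} inj {zero}  {zero}  _ = refl
↑-injective {ρ = ρ} inj {zero}  {suc y} e with () ← trans e (lookup-map y suc ρ)
↑-injective {ρ = ρ} inj {suc x} {zero}  e with () ← trans (sym (lookup-map x suc ρ)) e
↑-injective {ρ = ρ} inj {suc x} {suc y} e =
  cong suc (inj (Fin.suc-injective (trans (sym (lookup-map x suc ρ)) (trans e (lookup-map y suc ρ)))))

id-injective : Inj (V.id {m})
id-injective {x = x} {y} e = trans (sym (VarLemmas.lookup-id x)) (trans e (VarLemmas.lookup-id y))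

wk-injective : Inj (V.wk {m})
wk-injective {x = x} {y} e =
  Fin.suc-injective (trans (sym (VarLemmas.lookup-wk x)) (trans e (VarLemmas.lookup-wk y)))

-- Needed to reflect redexes along a renaming: identifying two type variables could make an
-- annotation agree with the type of the head and so create a redex.
/Var-injective : {ρ : Sub Fin m n} → Inj ρ → Injective _≡_ _≡_ (_/Var ρ)
/Var-injective inj {var X} {var Y}   e = cong var (inj (var-injective e))
/Var-injective inj {A ⊃ B} {A′ ⊃ B′} e with eA , eB ← ⊃-injective e =
  cong₂ _⊃_ (/Var-injective inj eA) (/Var-injective inj eB)
/Var-injective inj {A ∧ B} {A′ ∧ B′} e with eA , eB ← ∧-injective e =
  cong₂ _∧_ (/Var-injective inj eA) (/Var-injective inj eB)
/Var-injective inj {∀̇ A}   {∀̇ B}     e =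
  cong ∀̇ (/Var-injective (↑-injective inj) (∀̇-injective e))

-- Renaming in terms

rename-⊙ : ∀ {k l} (ρ₁ : Sub Fin m m′) (σ₁ : Sub Fin n n′) (ρ₂ : Sub Fin m′ k) (σ₂ : Sub Fin n′ l)
           (M : Tm m n) → rename ρ₂ σ₂ (rename ρ₁ σ₁ M) ≡ rename (ρ₁ V.⊙ ρ₂) (σ₁ V.⊙ σ₂) M
rename-⊙ ρ₁ σ₁ ρ₂ σ₂ (` x) = cong `_ (sym (VarLemmas.lookup-⊙ x {ρ₁ = σ₁} {σ₂}))
rename-⊙ ρ₁ σ₁ ρ₂ σ₂ (ƛ A M) = cong₂ ƛ (/Var-⊙ A)
  (trans (rename-⊙ ρ₁ (σ₁ V.↑) ρ₂ (σ₂ V.↑) M)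
         (cong (λ σ → rename (ρ₁ V.⊙ ρ₂) σ M) (sym (VarLemmas.↑⋆-distrib 1))))
rename-⊙ ρ₁ σ₁ ρ₂ σ₂ (M · N) = cong₂ _·_ (rename-⊙ ρ₁ σ₁ ρ₂ σ₂ M) (rename-⊙ ρ₁ σ₁ ρ₂ σ₂ N)
rename-⊙ ρ₁ σ₁ ρ₂ σ₂ ⟨ M , N ⟩ = cong₂ ⟨_,_⟩ (rename-⊙ ρ₁ σ₁ ρ₂ σ₂ M) (rename-⊙ ρ₁ σ₁ ρ₂ σ₂ N)
rename-⊙ ρ₁ σ₁ ρ₂ σ₂ (M ·₁) = cong _·₁ (rename-⊙ ρ₁ σ₁ ρ₂ σ₂ M)
rename-⊙ ρ₁ σ₁ ρ₂ σ₂ (M ·₂) = cong _·₂ (rename-⊙ ρ₁ σ₁ ρ₂ σ₂ M)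
rename-⊙ ρ₁ σ₁ ρ₂ σ₂ (Λ M) = cong Λ
  (trans (rename-⊙ (ρ₁ V.↑) σ₁ (ρ₂ V.↑) σ₂ M)
         (cong (λ ρ → rename ρ (σ₁ V.⊙ σ₂) M) (sym (VarLemmas.↑⋆-distrib 1))))
rename-⊙ ρ₁ σ₁ ρ₂ σ₂ (M ·ᵗ A) = cong₂ _·ᵗ_ (rename-⊙ ρ₁ σ₁ ρ₂ σ₂ M) (/Var-⊙ A)

rename-commutes : ∀ {k l m″ n″} {ρ₁ : Sub Fin m m′} {σ₁ : Sub Fin n n′}
  {ρ₂ : Sub Fin m′ k} {σ₂ : Sub Fin n′ l} {ρ₃ : Sub Fin m m″} {σ₃ : Sub Fin n n″}
  {ρ₄ : Sub Fin m″ k} {σ₄ : Sub Fin n″ l} (M : Tm m n) →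
  ρ₁ V.⊙ ρ₂ ≡ ρ₃ V.⊙ ρ₄ → σ₁ V.⊙ σ₂ ≡ σ₃ V.⊙ σ₄ →
  rename ρ₂ σ₂ (rename ρ₁ σ₁ M) ≡ rename ρ₄ σ₄ (rename ρ₃ σ₃ M)
rename-commutes {ρ₁ = ρ₁} {σ₁} {ρ₂} {σ₂} {ρ₃} {σ₃} {ρ₄} {σ₄} M eρ eσ =
  trans (rename-⊙ ρ₁ σ₁ ρ₂ σ₂ M)
        (trans (cong₂ (λ ρ σ → rename ρ σ M) eρ eσ) (sym (rename-⊙ ρ₃ σ₃ ρ₄ σ₄ M)))

id-commutes : {ρ : Sub Fin m n} → V.id V.⊙ ρ ≡ ρ V.⊙ V.id
id-commutes = trans VarLemmas.id-⊙ (sym VarLemmas.⊙-id)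

module _ (ρ : Sub Fin m m′) (σ : Sub Fin n n′) where

  rename-⇑ : ∀ M → rename ρ (σ V.↑) (M ⇑) ≡ rename ρ σ M ⇑
  rename-⇑ M = rename-commutes M id-commutes (sym VarLemmas.⊙-wk)

  rename-⇑₁ : ∀ M → rename ρ (σ V.↑ V.↑) (M ⇑₁) ≡ rename ρ (σ V.↑) M ⇑₁
  rename-⇑₁ M = rename-commutes M id-commutes
    (trans (sym (VarLemmas.↑⋆-distrib 1))
           (trans (cong V._↑ (sym VarLemmas.⊙-wk)) (VarLemmas.↑⋆-distrib 1)))

  rename-⇑ᵗ : ∀ M → rename (ρ V.↑) σ (M ⇑ᵗ) ≡ rename ρ σ M ⇑ᵗ
  rename-⇑ᵗ M = rename-commutes M (sym VarLemmas.⊙-wk) id-commutes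

rename-case̲ : ∀ (ρ : Sub Fin m m′) (σ : Sub Fin n n′) M A P B Q C →
  rename ρ σ (case̲ M A P B Q C) ≡
  case̲ (rename ρ σ M) (A /Var ρ) (rename ρ (σ V.↑) P) (B /Var ρ) (rename ρ (σ V.↑) Q) (C /Var ρ)
rename-case̲ ρ σ M A P B Q (var X) = refl
rename-case̲ ρ σ M A P B Q (C ⊃ D)
  rewrite sym (rename-⇑ ρ σ M) | sym (rename-⇑₁ ρ σ P) | sym (rename-⇑₁ ρ σ Q) =
  cong (ƛ _) (rename-case̲ ρ (σ V.↑) (M ⇑) A (P ⇑₁ · ` suc zero) B (Q ⇑₁ · ` suc zero) D)
rename-case̲ ρ σ M A P B Q (C₁ ∧ C₂) =
  cong₂ ⟨_,_⟩ (rename-case̲ ρ σ M A (P ·₁) B (Q ·₁) C₁) (rename-case̲ ρ σ M A (P ·₂) B (Q ·₂) C₂)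
rename-case̲ ρ σ M A P B Q (∀̇ C)
  rewrite sym (rename-⇑ᵗ ρ σ M) | sym (rename-⇑ᵗ ρ (σ V.↑) P) | sym (rename-⇑ᵗ ρ (σ V.↑) Q)
        | sym (weaken-/Var A {ρ}) | sym (weaken-/Var B {ρ}) =
  cong Λ (rename-case̲ (ρ V.↑) σ (M ⇑ᵗ) (weaken A) (P ⇑ᵗ ·ᵗ var zero) (weaken B) (Q ⇑ᵗ ·ᵗ var zero) C)

rename-abort̲ : ∀ (ρ : Sub Fin m m′) (σ : Sub Fin n n′) M A →
  rename ρ σ (abort̲ M A) ≡ abort̲ (rename ρ σ M) (A /Var ρ)
rename-abort̲ ρ σ M (var X) = refl
rename-abort̲ ρ σ M (A ⊃ B) rewrite sym (rename-⇑ ρ σ M) =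
  cong (ƛ _) (rename-abort̲ ρ (σ V.↑) (M ⇑) B)
rename-abort̲ ρ σ M (A ∧ B) = cong₂ ⟨_,_⟩ (rename-abort̲ ρ σ M A) (rename-abort̲ ρ σ M B)
rename-abort̲ ρ σ M (∀̇ A) rewrite sym (rename-⇑ᵗ ρ σ M) =
  cong Λ (rename-abort̲ (ρ V.↑) σ (M ⇑ᵗ) A)

-- Covers the three weakenings `⇑`, `⇑₁` and `⇑ᵗ` at once, so that typing, `tyOf`, `nf` and fine
-- steps each need a single renaming lemma.
record Renames (ρ : Sub Fin m m′) (σ : Sub Fin n n′) (Γ : Ctx m n) (Γ′ : Ctx m′ n′) : Set where
  constructor renames
  field lookup-renamed : ∀ x → lookup Γ′ (lookup σ x) ≡ lookup Γ x /Var ρ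

open Renames

module _ {ρ : Sub Fin m m′} {σ : Sub Fin n n′}
         {Γ : Ctx m n} {Γ′ : Ctx m′ n′} (r : Renames ρ σ Γ Γ′) where

  Renames-∷ : ∀ A → Renames ρ (σ V.↑) (A ∷ Γ) (A /Var ρ ∷ Γ′)
  Renames-∷ A .lookup-renamed zero    = refl
  Renames-∷ A .lookup-renamed (suc x) =
    trans (cong (lookup (A /Var ρ ∷ Γ′)) (lookup-map x suc σ)) (r .lookup-renamed x)

  Renames-⇑ᶜ : Renames (ρ V.↑) σ (Γ ⇑ᶜ) (Γ′ ⇑ᶜ)
  Renames-⇑ᶜ .lookup-renamed x
    rewrite lookup-map (lookup σ x) weaken Γ′ | lookup-map x weaken Γ | r .lookup-renamed x =
    sym (weaken-/Var (lookup Γ x))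

module _ {Γ : Ctx m n} where

  Renames-wk : ∀ {A} → Renames V.id V.wk Γ (A ∷ Γ)
  Renames-wk {A} .lookup-renamed x =
    trans (cong (lookup (A ∷ Γ)) (VarLemmas.lookup-wk x)) (sym (/Var-id (lookup Γ x)))

  Renames-wk↑ : ∀ {A B} → Renames V.id (V.wk V.↑) (A ∷ Γ) (A ∷ B ∷ Γ)
  Renames-wk↑ {A} {B} =
    subst (λ A′ → Renames V.id (V.wk V.↑) (A ∷ Γ) (A′ ∷ B ∷ Γ)) (/Var-id A) (Renames-∷ Renames-wk A)

  Renames-wkᵗ : Renames V.wk V.id Γ (Γ ⇑ᶜ)
  Renames-wkᵗ .lookup-renamed x =
    trans (cong (lookup (Γ ⇑ᶜ)) (VarLemmas.lookup-id x)) (lookup-map x weaken Γ)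

-- Typing

⊢-rename : ∀ {ρ : Sub Fin m m′} {σ : Sub Fin n n′} {Γ Γ′ M A} →
  Renames ρ σ Γ Γ′ → Γ ⊢ M ∶ A → Γ′ ⊢ rename ρ σ M ∶ A /Var ρ
⊢-rename {σ = σ} {Γ′ = Γ′} r (ax x) = subst (Γ′ ⊢ _ ∶_) (r .lookup-renamed x) (ax (lookup σ x))
⊢-rename r (⊃I t) = ⊃I (⊢-rename (Renames-∷ r _) t)
⊢-rename r (⊃E t u) = ⊃E (⊢-rename r t) (⊢-rename r u)
⊢-rename r (∧I t u) = ∧I (⊢-rename r t) (⊢-rename r u)
⊢-rename r (∧E₁ t) = ∧E₁ (⊢-rename r t)
⊢-rename r (∧E₂ t) = ∧E₂ (⊢-rename r t)
⊢-rename r (∀I t) = ∀I (⊢-rename (Renames-⇑ᶜ r) t)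
⊢-rename {Γ′ = Γ′} r (∀E {A} B t) =
  subst (Γ′ ⊢ _ ∶_) (sym (sub-commutes-with-renaming {t = A})) (∀E _ (⊢-rename r t))

module _ {Γ : Ctx m n} where

  ⊢-⇑ : ∀ {M A B} → Γ ⊢ M ∶ A → B ∷ Γ ⊢ M ⇑ ∶ A
  ⊢-⇑ {A = A} t = subst (_ ⊢ _ ∶_) (/Var-id A) (⊢-rename Renames-wk t)

  ⊢-⇑₁ : ∀ {M A B C} → A ∷ Γ ⊢ M ∶ C → A ∷ B ∷ Γ ⊢ M ⇑₁ ∶ C
  ⊢-⇑₁ {C = C} t = subst (_ ⊢ _ ∶_) (/Var-id C) (⊢-rename Renames-wk↑ t)

  ⊢-⇑ᵗ : ∀ {M A} → Γ ⊢ M ∶ A → Γ ⇑ᶜ ⊢ M ⇑ᵗ ∶ weaken A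
  ⊢-⇑ᵗ = ⊢-rename Renames-wkᵗ

  ⊢-⇑ᵗ-var : ∀ {M A} → Γ ⊢ M ∶ ∀̇ A → Γ ⇑ᶜ ⊢ M ⇑ᵗ ·ᵗ var zero ∶ A
  ⊢-⇑ᵗ-var {A = A} t = subst (_ ⊢ _ ∶_) (wk↑-sub-zero A) (∀E (var zero) (⊢-⇑ᵗ t))

  ⊢-⊻ᵗ : ∀ {M A B} → Γ ⊢ M ∶ A ⊻ B → Γ ⇑ᶜ ⊢ M ⇑ᵗ ∶ weaken A ⊻ weaken B
  ⊢-⊻ᵗ {M} {A} {B} t = subst (Γ ⇑ᶜ ⊢ M ⇑ᵗ ∶_) (⊻-/Var A B) (⊢-⇑ᵗ t)

  -- Inside `⊻` both `A` and `B` are weakened past the binder, so substituting for the bound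
  -- variable gives them back unchanged.
  ⊢-inst : ∀ {M A B} C → Γ ⊢ M ∶ A ⊻ B → Γ ⊢ M ·ᵗ C ∶ (A ⊃ C) ∧ (B ⊃ C) ⊃ C
  ⊢-inst {M} {A} {B} C t =
    subst₂ (λ A′ B′ → Γ ⊢ M ·ᵗ C ∶ (A′ ⊃ C) ∧ (B′ ⊃ C) ⊃ C) (weaken-sub A) (weaken-sub B) (∀E C t)

  ⊢-case : ∀ {M A B C P Q} → Γ ⊢ M ∶ A ⊻ B → A ∷ Γ ⊢ P ∶ C → B ∷ Γ ⊢ Q ∶ C →
           Γ ⊢ M ·ᵗ C · ⟨ ƛ A P , ƛ B Q ⟩ ∶ C
  ⊢-case {C = C} t p q = ⊃E (⊢-inst C t) (∧I (⊃I p) (⊃I q))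

-- Being total, tyOf commutes with renaming on all raw terms; its value is junk
-- on untypable ones.

cod fst snd : Ty m → Ty m
cod (A ⊃ B) = B
cod A       = A
fst (A ∧ B) = A
fst A       = A
snd (A ∧ B) = B
snd A       = A

inst : Ty m → Ty m → Ty m
inst (∀̇ A) B = A / sub B
inst A     B = A

tyOf : Ctx m n → Tm m n → Ty m
tyOf Γ (` x)     = lookup Γ x
tyOf Γ (ƛ A M)   = A ⊃ tyOf (A ∷ Γ) M
tyOf Γ (M · N)   = cod (tyOf Γ M)
tyOf Γ ⟨ M , N ⟩ = tyOf Γ M ∧ tyOf Γ N
tyOf Γ (M ·₁)    = fst (tyOf Γ M)
tyOf Γ (M ·₂)    = snd (tyOf Γ M)
tyOf Γ (Λ M)     = ∀̇ (tyOf (Γ ⇑ᶜ) M)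
tyOf Γ (M ·ᵗ B)  = inst (tyOf Γ M) B

⊢⇒tyOf : ∀ {Γ : Ctx m n} {M A} → Γ ⊢ M ∶ A → tyOf Γ M ≡ A
⊢⇒tyOf (ax x)   = refl
⊢⇒tyOf (⊃I t)   = cong (_ ⊃_) (⊢⇒tyOf t)
⊢⇒tyOf (⊃E t u) = cong cod (⊢⇒tyOf t)
⊢⇒tyOf (∧I t u) = cong₂ _∧_ (⊢⇒tyOf t) (⊢⇒tyOf u)
⊢⇒tyOf (∧E₁ t)  = cong fst (⊢⇒tyOf t)
⊢⇒tyOf (∧E₂ t)  = cong snd (⊢⇒tyOf t)
⊢⇒tyOf (∀I t)   = cong ∀̇ (⊢⇒tyOf t)
⊢⇒tyOf (∀E B t) = cong (λ A → inst A B) (⊢⇒tyOf t)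

⊢-unique : ∀ {Γ : Ctx m n} {M A B} → Γ ⊢ M ∶ A → Γ ⊢ M ∶ B → A ≡ B
⊢-unique t u = trans (sym (⊢⇒tyOf t)) (⊢⇒tyOf u)

-- The junk cases go through because the default value of `cod` is its own argument, which is
-- renamed along with it. The same choice works for `fst`, `snd` and `inst`.
cod-/Var : (A : Ty m) {ρ : Sub Fin m n} → cod (A /Var ρ) ≡ cod A /Var ρ
cod-/Var (var X) = refl
cod-/Var (A ⊃ B) = refl
cod-/Var (A ∧ B) = refl
cod-/Var (∀̇ A)   = refl

fst-/Var : (A : Ty m) {ρ : Sub Fin m n} → fst (A /Var ρ) ≡ fst A /Var ρ
fst-/Var (var X) = refl
fst-/Var (A ⊃ B) = refl
fst-/Var (A ∧ B) = refl
fst-/Var (∀̇ A)   = refl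

snd-/Var : (A : Ty m) {ρ : Sub Fin m n} → snd (A /Var ρ) ≡ snd A /Var ρ
snd-/Var (var X) = refl
snd-/Var (A ⊃ B) = refl
snd-/Var (A ∧ B) = refl
snd-/Var (∀̇ A)   = refl

inst-/Var : (A B : Ty m) {ρ : Sub Fin m n} → inst (A /Var ρ) (B /Var ρ) ≡ inst A B /Var ρ
inst-/Var (var X) B = refl
inst-/Var (A ⊃ _) B = refl
inst-/Var (A ∧ _) B = refl
inst-/Var (∀̇ A)   B = sym (sub-commutes-with-renaming {t = A})

tyOf-rename : ∀ {ρ : Sub Fin m m′} {σ : Sub Fin n n′} {Γ Γ′} → Renames ρ σ Γ Γ′ →
  ∀ M → tyOf Γ′ (rename ρ σ M) ≡ tyOf Γ M /Var ρ
tyOf-rename r (` x) = r .lookup-renamed x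
tyOf-rename r (ƛ A M) = cong (_ ⊃_) (tyOf-rename (Renames-∷ r A) M)
tyOf-rename {Γ = Γ} r (M · N) = trans (cong cod (tyOf-rename r M)) (cod-/Var (tyOf Γ M))
tyOf-rename r ⟨ M , N ⟩ = cong₂ _∧_ (tyOf-rename r M) (tyOf-rename r N)
tyOf-rename {Γ = Γ} r (M ·₁) = trans (cong fst (tyOf-rename r M)) (fst-/Var (tyOf Γ M))
tyOf-rename {Γ = Γ} r (M ·₂) = trans (cong snd (tyOf-rename r M)) (snd-/Var (tyOf Γ M))
tyOf-rename r (Λ M) = cong ∀̇ (tyOf-rename (Renames-⇑ᶜ r) M)
tyOf-rename {Γ = Γ} r (M ·ᵗ B) =
  trans (cong (λ A → inst A _) (tyOf-rename r M)) (inst-/Var (tyOf Γ M) B)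

module _ {Γ : Ctx m n} where

  tyOf-⇑ : ∀ {A} M → tyOf (A ∷ Γ) (M ⇑) ≡ tyOf Γ M
  tyOf-⇑ M = trans (tyOf-rename Renames-wk M) (/Var-id (tyOf Γ M))

  tyOf-⇑ᵗ : ∀ M → tyOf (Γ ⇑ᶜ) (M ⇑ᵗ) ≡ weaken (tyOf Γ M)
  tyOf-⇑ᵗ M = tyOf-rename Renames-wkᵗ M

  tyOf-⊻ᵗ : ∀ {A B} M → tyOf Γ M ≡ A ⊻ B → tyOf (Γ ⇑ᶜ) (M ⇑ᵗ) ≡ weaken A ⊻ weaken B
  tyOf-⊻ᵗ {A} {B} M e = trans (tyOf-⇑ᵗ M) (trans (cong weaken e) (⊻-/Var A B))

-- Since `tyOf` reads the type of an application off its function part, the variable clause is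
-- settled by the types of `M` and `X`, whatever the branches are.
tyOf-case̲ : ∀ {Γ : Ctx m n} {M A P B Q} C → tyOf Γ M ≡ A ⊻ B → tyOf Γ (case̲ M A P B Q C) ≡ C
tyOf-case̲ (var X) e = cong (λ D → cod (inst D (var X))) e
tyOf-case̲ {M = M} {A} {B = B} (C ⊃ D) e = cong (C ⊃_) (tyOf-case̲ {A = A} {B = B} D (trans (tyOf-⇑ M) e))
tyOf-case̲ {A = A} {B = B} (C₁ ∧ C₂) e =
  cong₂ _∧_ (tyOf-case̲ {A = A} {B = B} C₁ e) (tyOf-case̲ {A = A} {B = B} C₂ e)
tyOf-case̲ {M = M} {A} {B = B} (∀̇ C) e =
  cong ∀̇ (tyOf-case̲ {A = weaken A} {B = weaken B} C (tyOf-⊻ᵗ {A = A} {B} M e))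

tyOf-abort̲ : ∀ {Γ : Ctx m n} {M} C → tyOf Γ M ≡ ⊥̲ → tyOf Γ (abort̲ M C) ≡ C
tyOf-abort̲ (var X) e = cong (λ D → inst D (var X)) e
tyOf-abort̲ {M = M} (C ⊃ D) e = cong (C ⊃_) (tyOf-abort̲ D (trans (tyOf-⇑ M) e))
tyOf-abort̲ (C₁ ∧ C₂) e = cong₂ _∧_ (tyOf-abort̲ C₁ e) (tyOf-abort̲ C₂ e)
tyOf-abort̲ {M = M} (∀̇ C) e = cong ∀̇ (tyOf-abort̲ C (trans (tyOf-⇑ᵗ M) (cong weaken e)))

-- Fine normal forms

-- The condition on `tyOf` stands in for typability of the head: it is decidable, stable under
-- renaming, and follows from the typing that fineness demands.
data CaseRedex (Γ : Ctx m n) : Tm m n → Tm m n → Set where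
  caseRedex : ∀ {M A B C P Q} → tyOf Γ M ≡ A ⊻ B → CaseRedex Γ (M ·ᵗ C) ⟨ ƛ A P , ƛ B Q ⟩

contract : ∀ {Γ : Ctx m n} {M N} → CaseRedex Γ M N → Tm m n
contract (caseRedex {M} {A} {B} {C} {P} {Q} _) = case̲ M A P B Q C

-- The purely syntactic half of `CaseRedex`. Deciding it separately lets one equation refute all
-- other pairs of term formers.
data CaseShape {m n} : Tm m n → Tm m n → Set where
  caseShape : ∀ {M A B C P Q} → CaseShape (M ·ᵗ C) ⟨ ƛ A P , ƛ B Q ⟩

caseShape? : (M N : Tm m n) → Maybe (CaseShape M N)
caseShape? (M ·ᵗ C) ⟨ ƛ A P , ƛ B Q ⟩ = just caseShape
caseShape? _ _ = nothing

caseRedex? : ∀ (Γ : Ctx m n) M N → Dec (CaseRedex Γ M N)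
caseRedex? Γ M N with caseShape? M N in eq
... | just (caseShape {M} {A} {B}) =
  map′ caseRedex (λ { (caseRedex e) → e }) (tyOf Γ M ≟ A ⊻ B)
... | nothing = no λ { (caseRedex _) → contradiction eq λ () }

app : Ctx m n → Tm m n → Tm m n → Tm m n
app Γ M N with caseRedex? Γ M N
... | yes r = contract r
... | no  _ = M · N

inst⊥ : Ctx m n → Tm m n → Ty m → Tm m n
inst⊥ Γ M C with tyOf Γ M ≟ ⊥̲
... | yes _ = abort̲ M C
... | no  _ = M ·ᵗ C

-- Redexes are contracted after normalising the immediate subterms, because
-- the argument of a case may only then become a pair of abstractions.
nf : Ctx m n → Tm m n → Tm m n
nf Γ (` x)     = ` x
nf Γ (ƛ A M)   = ƛ A (nf (A ∷ Γ) M)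
nf Γ (M · N)   = app Γ (nf Γ M) (nf Γ N)
nf Γ ⟨ M , N ⟩ = ⟨ nf Γ M , nf Γ N ⟩
nf Γ (M ·₁)    = nf Γ M ·₁
nf Γ (M ·₂)    = nf Γ M ·₂
nf Γ (Λ M)     = Λ (nf (Γ ⇑ᶜ) M)
nf Γ (M ·ᵗ B)  = inst⊥ Γ (nf Γ M) B

module _ {Γ : Ctx m n} where

  contract-unique : ∀ {M N} (r s : CaseRedex Γ M N) → contract r ≡ contract s
  contract-unique (caseRedex _) (caseRedex _) = refl

  app-redex : ∀ {M N} (r : CaseRedex Γ M N) → app Γ M N ≡ contract r
  app-redex {M} {N} r with caseRedex? Γ M N
  ... | yes s = contract-unique s r
  ... | no ¬r = contradiction r ¬r

  app-stuck : ∀ {M N} → ¬ CaseRedex Γ M N → app Γ M N ≡ M · N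
  app-stuck {M} {N} ¬r with caseRedex? Γ M N
  ... | yes r = contradiction r ¬r
  ... | no _  = refl

  inst⊥-⊥ : ∀ {M C} → tyOf Γ M ≡ ⊥̲ → inst⊥ Γ M C ≡ abort̲ M C
  inst⊥-⊥ {M} e with tyOf Γ M ≟ ⊥̲
  ... | yes _ = refl
  ... | no ¬e = contradiction e ¬e

  inst⊥-¬⊥ : ∀ {M C} → tyOf Γ M ≢ ⊥̲ → inst⊥ Γ M C ≡ M ·ᵗ C
  inst⊥-¬⊥ {M} ¬e with tyOf Γ M ≟ ⊥̲
  ... | yes e = contradiction e ¬e
  ... | no _  = refl

  inst⊥-var : ∀ {M X} → inst⊥ Γ M (var X) ≡ M ·ᵗ var X
  inst⊥-var {M} with tyOf Γ M ≟ ⊥̲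
  ... | yes _ = refl
  ... | no _  = refl

  tyOf-app : ∀ M N → tyOf Γ (app Γ M N) ≡ cod (tyOf Γ M)
  tyOf-app M N with caseRedex? Γ M N
  ... | yes (caseRedex {A = A} {B} {C} e) =
    trans (tyOf-case̲ {A = A} {B = B} C e) (cong (λ D → cod (inst D C)) (sym e))
  ... | no _ = refl

  tyOf-inst⊥ : ∀ M C → tyOf Γ (inst⊥ Γ M C) ≡ inst (tyOf Γ M) C
  tyOf-inst⊥ M C with tyOf Γ M ≟ ⊥̲
  ... | yes e = trans (tyOf-abort̲ C e) (cong (λ D → inst D C) (sym e))
  ... | no _  = refl

-- Ensures that the tests `nf` makes on already normalised subterms give the answer that the
-- original subterms would give.
tyOf-nf : ∀ (Γ : Ctx m n) M → tyOf Γ (nf Γ M) ≡ tyOf Γ M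
tyOf-nf Γ (` x)     = refl
tyOf-nf Γ (ƛ A M)   = cong (A ⊃_) (tyOf-nf (A ∷ Γ) M)
tyOf-nf Γ (M · N)   = trans (tyOf-app (nf Γ M) (nf Γ N)) (cong cod (tyOf-nf Γ M))
tyOf-nf Γ ⟨ M , N ⟩ = cong₂ _∧_ (tyOf-nf Γ M) (tyOf-nf Γ N)
tyOf-nf Γ (M ·₁)    = cong fst (tyOf-nf Γ M)
tyOf-nf Γ (M ·₂)    = cong snd (tyOf-nf Γ M)
tyOf-nf Γ (Λ M)     = cong ∀̇ (tyOf-nf (Γ ⇑ᶜ) M)
tyOf-nf Γ (M ·ᵗ B)  = trans (tyOf-inst⊥ (nf Γ M) B) (cong (λ A → inst A B) (tyOf-nf Γ M))

-- Commutation of normalisation with renaming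

module _ {ρ : Sub Fin m m′} {σ : Sub Fin n n′}
         {Γ : Ctx m n} {Γ′ : Ctx m′ n′} (inj : Inj ρ) (r : Renames ρ σ Γ Γ′) where

  CaseRedex-rename : ∀ {M N} → CaseRedex Γ M N → CaseRedex Γ′ (rename ρ σ M) (rename ρ σ N)
  CaseRedex-rename (caseRedex {M} {A} {B} e) =
    caseRedex (trans (tyOf-rename r M) (trans (cong (_/Var ρ) e) (⊻-/Var A B)))

  contract-rename : ∀ {M N} (redex : CaseRedex Γ M N) →
                    contract (CaseRedex-rename redex) ≡ rename ρ σ (contract redex)
  contract-rename (caseRedex {M} {A} {B} {C} {P} {Q} _) = sym (rename-case̲ ρ σ M A P B Q C)

  -- Renaming preserves and reflects term formers, so the shape is already present in `M` and `N`;
  -- the type condition is reflected by injectivity. The equations keep the indices of the given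
  -- redex general enough to match on.
  CaseRedex-rename⁻ : ∀ M N {M′ N′} → CaseRedex Γ′ M′ N′ →
                      rename ρ σ M ≡ M′ → rename ρ σ N ≡ N′ → CaseRedex Γ M N
  CaseRedex-rename⁻ (M ·ᵗ C) ⟨ ƛ A P , ƛ B Q ⟩ (caseRedex e) refl refl =
    caseRedex (/Var-injective inj (trans (sym (tyOf-rename r M)) (trans e (sym (⊻-/Var A B)))))

  app-rename : ∀ M N → app Γ′ (rename ρ σ M) (rename ρ σ N) ≡ rename ρ σ (app Γ M N)
  app-rename M N with caseRedex? Γ M N
  ... | yes redex = trans (app-redex (CaseRedex-rename redex)) (contract-rename redex)
  ... | no ¬redex = app-stuck λ redex → ¬redex (CaseRedex-rename⁻ M N redex refl refl)

  inst⊥-rename : ∀ M C → inst⊥ Γ′ (rename ρ σ M) (C /Var ρ) ≡ rename ρ σ (inst⊥ Γ M C)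
  inst⊥-rename M C with tyOf Γ M ≟ ⊥̲
  ... | yes e = trans (inst⊥-⊥ (trans (tyOf-rename r M) (cong (_/Var ρ) e)))
                      (sym (rename-abort̲ ρ σ M C))
  ... | no ¬e = inst⊥-¬⊥ λ e → ¬e (/Var-injective inj (trans (sym (tyOf-rename r M)) e))

nf-rename : ∀ {ρ : Sub Fin m m′} {σ : Sub Fin n n′} {Γ Γ′} → Inj ρ → Renames ρ σ Γ Γ′ →
            ∀ M → nf Γ′ (rename ρ σ M) ≡ rename ρ σ (nf Γ M)
nf-rename inj r (` x)     = refl
nf-rename inj r (ƛ A M)   = cong (ƛ _) (nf-rename inj (Renames-∷ r A) M)
nf-rename {Γ = Γ} {Γ′} inj r (M · N) =
  trans (cong₂ (app Γ′) (nf-rename inj r M) (nf-rename inj r N)) (app-rename inj r (nf Γ M) (nf Γ N))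
nf-rename inj r ⟨ M , N ⟩ = cong₂ ⟨_,_⟩ (nf-rename inj r M) (nf-rename inj r N)
nf-rename inj r (M ·₁)    = cong _·₁ (nf-rename inj r M)
nf-rename inj r (M ·₂)    = cong _·₂ (nf-rename inj r M)
nf-rename inj r (Λ M)     = cong Λ (nf-rename (↑-injective inj) (Renames-⇑ᶜ r) M)
nf-rename {Γ = Γ} {Γ′} inj r (M ·ᵗ B) =
  trans (cong (λ M′ → inst⊥ Γ′ M′ _) (nf-rename inj r M)) (inst⊥-rename inj r (nf Γ M) B)

module _ {Γ : Ctx m n} where

  nf-⇑ : ∀ {A} M → nf (A ∷ Γ) (M ⇑) ≡ nf Γ M ⇑
  nf-⇑ = nf-rename id-injective Renames-wk

  -- An argument that is a variable is not a pair, so expanding a branch this way creates no case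
  -- redex.
  nf-⇑₁-· : ∀ {A B} P → nf (A ∷ B ∷ Γ) (P ⇑₁ · ` suc zero) ≡ nf (A ∷ Γ) P ⇑₁ · ` suc zero
  nf-⇑₁-· P = trans (app-stuck λ ()) (cong (_· _) (nf-rename id-injective Renames-wk↑ P))

  nf-⇑ᵗ : ∀ M → nf (Γ ⇑ᶜ) (M ⇑ᵗ) ≡ nf Γ M ⇑ᵗ
  nf-⇑ᵗ = nf-rename wk-injective Renames-wkᵗ

nf-⇑ᵗ-·ᵗ : ∀ {Γ : Ctx m n} P → nf (Γ ⇑ᶜ) (P ⇑ᵗ ·ᵗ var zero) ≡ nf Γ P ⇑ᵗ ·ᵗ var zero
nf-⇑ᵗ-·ᵗ P = trans inst⊥-var (cong (_·ᵗ var zero) (nf-⇑ᵗ P))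

-- Invariance of normalisation under fine reduction

nf-case : ∀ {Γ : Ctx m n} M {A B C P Q} → tyOf Γ M ≡ A ⊻ B →
  nf Γ (M ·ᵗ C · ⟨ ƛ A P , ƛ B Q ⟩) ≡ case̲ (nf Γ M) A (nf (A ∷ Γ) P) B (nf (B ∷ Γ) Q) C
nf-case {Γ = Γ} M {A} {B} {C} e
  -- The bodies of `A ⊻ B` and `⊥̲` under `∀̇` are an implication and a variable. The inner `M ·ᵗ C`
  -- is therefore not unfolded by `inst⊥`, and the case redex survives until `app` meets it.
  rewrite inst⊥-¬⊥ {Γ = Γ} {nf Γ M} {C}
    (λ e⊥ → contradiction (trans (sym e⊥) (trans (tyOf-nf Γ M) e)) λ ()) =
  app-redex (caseRedex (trans (tyOf-nf Γ M) e))

nf-abort : ∀ {Γ : Ctx m n} M {C} → tyOf Γ M ≡ ⊥̲ → nf Γ (M ·ᵗ C) ≡ abort̲ (nf Γ M) C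
nf-abort {Γ = Γ} M e = inst⊥-⊥ (trans (tyOf-nf Γ M) e)

-- A ϱ step peels off one clause of `case̲`. Its contractum consists of case redexes at smaller
-- types with a head of the same kind, so `nf-case` applies to both sides, and what remains is to
-- move `nf` through weakenings and expanded branches.
nf-ϱ : ∀ {Γ : Ctx m n} {M A B N N′} → tyOf Γ M ≡ A ⊻ B → ϱ-root M A B N N′ → nf Γ N ≡ nf Γ N′
nf-ϱ {Γ = Γ} {M} {A} {B} e (ϱ-⊃ {C₁} {C₂} {P} {Q}) = begin
  nf Γ (M ·ᵗ (C₁ ⊃ C₂) · ⟨ ƛ A P , ƛ B Q ⟩)
    ≡⟨ nf-case M {P = P} {Q} e ⟩
  case̲ (nf Γ M) A (nf (A ∷ Γ) P) B (nf (B ∷ Γ) Q) (C₁ ⊃ C₂)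
    ≡⟨ cong₂ (λ P′ Q′ → ƛ C₁ (case̲ (nf Γ M ⇑) A P′ B Q′ C₂)) (nf-⇑₁-· P) (nf-⇑₁-· Q) ⟨
  ƛ C₁ (case̲ (nf Γ M ⇑) A (nf (A ∷ C₁ ∷ Γ) (P ⇑₁ · ` suc zero))
                        B (nf (B ∷ C₁ ∷ Γ) (Q ⇑₁ · ` suc zero)) C₂)
    ≡⟨ cong (λ M′ → ƛ C₁ (case̲ M′ A _ B _ C₂)) (nf-⇑ M) ⟨
  ƛ C₁ (case̲ (nf (C₁ ∷ Γ) (M ⇑)) A _ B _ C₂)
    ≡⟨ cong (ƛ C₁) (nf-case (M ⇑) {A} {B} {P = P ⇑₁ · ` suc zero} {Q ⇑₁ · ` suc zero}
                          (trans (tyOf-⇑ M) e)) ⟨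
  ƛ C₁ (nf (C₁ ∷ Γ) (M ⇑ ·ᵗ C₂ · ⟨ ƛ A (P ⇑₁ · ` suc zero) , ƛ B (Q ⇑₁ · ` suc zero) ⟩))
    ∎
  where open ≡-Reasoning
nf-ϱ {M = M} {A} {B} e (ϱ-∧ {C₁} {C₂} {P} {Q}) = trans (nf-case M {P = P} {Q} e)
  (cong₂ ⟨_,_⟩ (sym (nf-case M {A} {B} {C₁} {P ·₁} {Q ·₁} e))
               (sym (nf-case M {A} {B} {C₂} {P ·₂} {Q ·₂} e)))
nf-ϱ {Γ = Γ} {M} {A} {B} e (ϱ-∀ {D} {P} {Q}) = begin
  nf Γ (M ·ᵗ ∀̇ D · ⟨ ƛ A P , ƛ B Q ⟩)
    ≡⟨ nf-case M {P = P} {Q} e ⟩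
  case̲ (nf Γ M) A (nf (A ∷ Γ) P) B (nf (B ∷ Γ) Q) (∀̇ D)
    ≡⟨ cong₂ (λ P′ Q′ → Λ (case̲ (nf Γ M ⇑ᵗ) (weaken A) P′ (weaken B) Q′ D)) (nf-⇑ᵗ-·ᵗ P) (nf-⇑ᵗ-·ᵗ Q) ⟨
  Λ (case̲ (nf Γ M ⇑ᵗ) (weaken A) (nf ((A ∷ Γ) ⇑ᶜ) (P ⇑ᵗ ·ᵗ var zero))
                      (weaken B) (nf ((B ∷ Γ) ⇑ᶜ) (Q ⇑ᵗ ·ᵗ var zero)) D)
    ≡⟨ cong (λ M′ → Λ (case̲ M′ (weaken A) _ (weaken B) _ D)) (nf-⇑ᵗ M) ⟨
  Λ (case̲ (nf (Γ ⇑ᶜ) (M ⇑ᵗ)) (weaken A) _ (weaken B) _ D)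
    ≡⟨ cong Λ (nf-case (M ⇑ᵗ) {weaken A} {weaken B} {P = P ⇑ᵗ ·ᵗ var zero} {Q ⇑ᵗ ·ᵗ var zero}
                       (tyOf-⊻ᵗ {A = A} {B} M e)) ⟨
  Λ (nf (Γ ⇑ᶜ) (M ⇑ᵗ ·ᵗ D · ⟨ ƛ (weaken A) (P ⇑ᵗ ·ᵗ var zero) , ƛ (weaken B) (Q ⇑ᵗ ·ᵗ var zero) ⟩))
    ∎
  where open ≡-Reasoning

nf-ρ : ∀ {Γ : Ctx m n} {M N N′} → tyOf Γ M ≡ ⊥̲ → ρ-root M N N′ → nf Γ N ≡ nf Γ N′
nf-ρ {Γ = Γ} {M} e (ρ-⊃ {C₁} {C₂}) = trans (nf-abort M e) (cong (ƛ C₁)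
  (trans (cong (λ M′ → abort̲ M′ C₂) (sym (nf-⇑ M))) (sym (nf-abort (M ⇑) (trans (tyOf-⇑ M) e)))))
nf-ρ {M = M} e ρ-∧ =
  trans (nf-abort M e) (cong₂ ⟨_,_⟩ (sym (nf-abort M e)) (sym (nf-abort M e)))
nf-ρ {Γ = Γ} {M} e (ρ-∀ {D}) = trans (nf-abort M e) (cong Λ
  (trans (cong (λ M′ → abort̲ M′ D) (sym (nf-⇑ᵗ M)))
         (sym (nf-abort (M ⇑ᵗ) (trans (tyOf-⇑ᵗ M) (cong weaken e))))))

-- The typing carried by a fine root step determines `tyOf` of its head; the congruences hold
-- because `nf` depends on subterms only through their images.
nf-fine : ∀ {Γ : Ctx m n} {M M′} → Γ ⊢ M ⟶ M′ fine → nf Γ M ≡ nf Γ M′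
nf-fine (ϱ {A = A} {B} t s) = nf-ϱ {A = A} {B} (⊢⇒tyOf t) s
nf-fine (F.ρ t s) = nf-ρ (⊢⇒tyOf t) s
nf-fine (ξ-ƛ s)   = cong (ƛ _) (nf-fine s)
nf-fine {Γ = Γ} (ξ-·ˡ s) = cong (λ M → app Γ M _) (nf-fine s)
nf-fine {Γ = Γ} (ξ-·ʳ {N = N} s) = cong (app Γ (nf Γ N)) (nf-fine s)
nf-fine (ξ-⟨⟩ˡ s) = cong ⟨_, _ ⟩ (nf-fine s)
nf-fine (ξ-⟨⟩ʳ s) = cong ⟨ _ ,_⟩ (nf-fine s)
nf-fine (ξ-·₁ s)  = cong _·₁ (nf-fine s)
nf-fine (ξ-·₂ s)  = cong _·₂ (nf-fine s)
nf-fine (ξ-Λ s)   = cong Λ (nf-fine s)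
nf-fine {Γ = Γ} (ξ-·ᵗ s) = cong (λ M → inst⊥ Γ M _) (nf-fine s)

nf-fine* : ∀ {Γ : Ctx m n} {M M′} → Γ ⊢ M ⟶* M′ fine → nf Γ M ≡ nf Γ M′
nf-fine* ε        = refl
nf-fine* (s ◅ ss) = trans (nf-fine s) (nf-fine* ss)

-- Normalisation on fine normal forms

case-normal : ∀ {Γ : Ctx m n} {M A B P Q} C → Γ ⊢ M ∶ A ⊻ B →
  FineNormal Γ (M ·ᵗ C · ⟨ ƛ A P , ƛ B Q ⟩) → case̲ M A P B Q C ≡ M ·ᵗ C · ⟨ ƛ A P , ƛ B Q ⟩
case-normal (var X) t normal = refl
case-normal {A = A} {B} (_ ⊃ _) t normal = contradiction (ϱ {A = A} {B} t ϱ-⊃) (normal _)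
case-normal {A = A} {B} (_ ∧ _) t normal = contradiction (ϱ {A = A} {B} t ϱ-∧) (normal _)
case-normal {A = A} {B} (∀̇ _)   t normal = contradiction (ϱ {A = A} {B} t ϱ-∀) (normal _)

abort-normal : ∀ {Γ : Ctx m n} {M} C → Γ ⊢ M ∶ ⊥̲ → FineNormal Γ (M ·ᵗ C) → abort̲ M C ≡ M ·ᵗ C
abort-normal (var X) t normal = refl
abort-normal (_ ⊃ _) t normal = contradiction (F.ρ t ρ-⊃) (normal _)
abort-normal (_ ∧ _) t normal = contradiction (F.ρ t ρ-∧) (normal _)
abort-normal (∀̇ _)   t normal = contradiction (F.ρ t ρ-∀) (normal _)

-- Turns the `tyOf` test of a case redex into the derivation that a fine step must carry.
⊢-inst⁻ : ∀ {Γ : Ctx m n} {M C D} → Γ ⊢ M ·ᵗ C ∶ D → Γ ⊢ M ∶ tyOf Γ M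
⊢-inst⁻ (∀E C t) = subst (_ ⊢ _ ∶_) (sym (⊢⇒tyOf t)) t

app-normal : ∀ {Γ : Ctx m n} {M N A} → Γ ⊢ M ∶ A → FineNormal Γ (M · N) → app Γ M N ≡ M · N
app-normal {Γ = Γ} {M} {N} t normal with caseRedex? Γ M N
... | yes (caseRedex {C = C} e) = case-normal C (subst (_ ⊢ _ ∶_) e (⊢-inst⁻ t)) normal
... | no _ = refl

inst⊥-normal : ∀ {Γ : Ctx m n} {M C A} → Γ ⊢ M ∶ A → FineNormal Γ (M ·ᵗ C) → inst⊥ Γ M C ≡ M ·ᵗ C
inst⊥-normal {Γ = Γ} {M} {C} t normal with tyOf Γ M ≟ ⊥̲
... | yes e = abort-normal C (subst (_ ⊢ _ ∶_) (trans (sym (⊢⇒tyOf t)) e) t) normal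
... | no _  = refl

-- On untypable terms this can fail: a head with junk type `⊥̲` is unfolded by `nf` although no fine
-- step applies there.
nf-normal : ∀ {Γ : Ctx m n} {M A} → Γ ⊢ M ∶ A → FineNormal Γ M → nf Γ M ≡ M
nf-normal (ax x) normal = refl
nf-normal (⊃I t) normal = cong (ƛ _) (nf-normal t λ _ → normal _ ∘ ξ-ƛ)
nf-normal {Γ = Γ} (⊃E t u) normal =
  trans (cong₂ (app Γ) (nf-normal t λ _ → normal _ ∘ ξ-·ˡ) (nf-normal u λ _ → normal _ ∘ ξ-·ʳ))
        (app-normal t normal)
nf-normal (∧I t u) normal =
  cong₂ ⟨_,_⟩ (nf-normal t λ _ → normal _ ∘ ξ-⟨⟩ˡ) (nf-normal u λ _ → normal _ ∘ ξ-⟨⟩ʳ)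
nf-normal (∧E₁ t) normal = cong _·₁ (nf-normal t λ _ → normal _ ∘ ξ-·₁)
nf-normal (∧E₂ t) normal = cong _·₂ (nf-normal t λ _ → normal _ ∘ ξ-·₂)
nf-normal (∀I t) normal = cong Λ (nf-normal t λ _ → normal _ ∘ ξ-Λ)
nf-normal {Γ = Γ} (∀E B t) normal =
  trans (cong (λ M → inst⊥ Γ M B) (nf-normal t λ _ → normal _ ∘ ξ-·ᵗ)) (inst⊥-normal t normal)

-- Subject reduction

-- The derivation of the redex could a priori type its head differently. Uniqueness of types
-- identifies the two types of `M ·ᵗ C`, which fixes both branches and the result.
⊢-case⁻ : ∀ {Γ : Ctx m n} {M A B C D P Q} → Γ ⊢ M ∶ A ⊻ B →
  Γ ⊢ M ·ᵗ C · ⟨ ƛ A P , ƛ B Q ⟩ ∶ D → C ≡ D × (A ∷ Γ ⊢ P ∶ C) × (B ∷ Γ ⊢ Q ∶ C)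
⊢-case⁻ {A = A} {B} {C} t (⊃E u (∧I (⊃I p) (⊃I q)))
  with refl ← ⊢-unique (⊢-inst {A = A} {B} C t) u = refl , p , q

ϱ-preserves : ∀ {Γ : Ctx m n} {M A B N N′ D} → Γ ⊢ M ∶ A ⊻ B → ϱ-root M A B N N′ →
              Γ ⊢ N ∶ D → Γ ⊢ N′ ∶ D
ϱ-preserves {A = A} {B} t ϱ-⊃ u with refl , p , q ← ⊢-case⁻ {A = A} {B} t u =
  ⊃I (⊢-case {A = A} {B} (⊢-⇑ t) (⊃E (⊢-⇑₁ p) (ax (suc zero))) (⊃E (⊢-⇑₁ q) (ax (suc zero))))
ϱ-preserves {A = A} {B} t ϱ-∧ u with refl , p , q ← ⊢-case⁻ {A = A} {B} t u =
  ∧I (⊢-case {A = A} {B} t (∧E₁ p) (∧E₁ q)) (⊢-case {A = A} {B} t (∧E₂ p) (∧E₂ q))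
ϱ-preserves {A = A} {B} t ϱ-∀ u with refl , p , q ← ⊢-case⁻ {A = A} {B} t u =
  ∀I (⊢-case {A = weaken A} {weaken B} (⊢-⊻ᵗ {A = A} {B} t) (⊢-⇑ᵗ-var p) (⊢-⇑ᵗ-var q))

ρ-preserves : ∀ {Γ : Ctx m n} {M N N′ D} → Γ ⊢ M ∶ ⊥̲ → ρ-root M N N′ → Γ ⊢ N ∶ D → Γ ⊢ N′ ∶ D
ρ-preserves t (ρ-⊃ {C₁} {C₂}) u with refl ← ⊢-unique (∀E (C₁ ⊃ C₂) t) u = ⊃I (∀E C₂ (⊢-⇑ t))
ρ-preserves t (ρ-∧ {C₁} {C₂}) u with refl ← ⊢-unique (∀E (C₁ ∧ C₂) t) u = ∧I (∀E C₁ t) (∀E C₂ t)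
ρ-preserves t (ρ-∀ {D})       u with refl ← ⊢-unique (∀E (∀̇ D) t) u     = ∀I (∀E D (⊢-⇑ᵗ t))

fine-preserves : ∀ {Γ : Ctx m n} {M M′ A} → Γ ⊢ M ⟶ M′ fine → Γ ⊢ M ∶ A → Γ ⊢ M′ ∶ A
fine-preserves (ϱ {A = A} {B} t s) u = ϱ-preserves {A = A} {B} t s u
fine-preserves (F.ρ t s) u        = ρ-preserves t s u
fine-preserves (ξ-ƛ s)   (⊃I t)   = ⊃I (fine-preserves s t)
fine-preserves (ξ-·ˡ s)  (⊃E t u) = ⊃E (fine-preserves s t) u
fine-preserves (ξ-·ʳ s)  (⊃E t u) = ⊃E t (fine-preserves s u)
fine-preserves (ξ-⟨⟩ˡ s) (∧I t u) = ∧I (fine-preserves s t) u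
fine-preserves (ξ-⟨⟩ʳ s) (∧I t u) = ∧I t (fine-preserves s u)
fine-preserves (ξ-·₁ s)  (∧E₁ t)  = ∧E₁ (fine-preserves s t)
fine-preserves (ξ-·₂ s)  (∧E₂ t)  = ∧E₂ (fine-preserves s t)
fine-preserves (ξ-Λ s)   (∀I t)   = ∀I (fine-preserves s t)
fine-preserves (ξ-·ᵗ s)  (∀E B t) = ∀E B (fine-preserves s t)

fine*-preserves : ∀ {Γ : Ctx m n} {M M′ A} → Γ ⊢ M ⟶* M′ fine → Γ ⊢ M ∶ A → Γ ⊢ M′ ∶ A
fine*-preserves ε        t = t
fine*-preserves (s ◅ ss) t = fine*-preserves ss (fine-preserves s t)

-- The reduction from the Russell-Prawitz translation

ϱ-root-rename : ∀ (ρ : Sub Fin m m′) (σ : Sub Fin n n′) {M A B N N′} → ϱ-root M A B N N′ →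
  ϱ-root (rename ρ σ M) (A /Var ρ) (B /Var ρ) (rename ρ σ N) (rename ρ σ N′)
ϱ-root-rename ρ σ {M} (ϱ-⊃ {P = P} {Q})
  rewrite rename-⇑ ρ σ M | rename-⇑₁ ρ σ P | rename-⇑₁ ρ σ Q = ϱ-⊃
ϱ-root-rename ρ σ ϱ-∧ = ϱ-∧
ϱ-root-rename ρ σ {M} {A} {B} (ϱ-∀ {P = P} {Q})
  rewrite rename-⇑ᵗ ρ σ M | rename-⇑ᵗ ρ (σ V.↑) P | rename-⇑ᵗ ρ (σ V.↑) Q
        | weaken-/Var A {ρ} | weaken-/Var B {ρ} = ϱ-∀

ρ-root-rename : ∀ (ρ : Sub Fin m m′) (σ : Sub Fin n n′) {M N N′} → ρ-root M N N′ →
  ρ-root (rename ρ σ M) (rename ρ σ N) (rename ρ σ N′)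
ρ-root-rename ρ σ {M} ρ-⊃ rewrite rename-⇑ ρ σ M = ρ-⊃
ρ-root-rename ρ σ ρ-∧ = ρ-∧
ρ-root-rename ρ σ {M} ρ-∀ rewrite rename-⇑ᵗ ρ σ M = ρ-∀

-- Translated injections put their subterm under `⇑ᵗ` and `⇑`, so its reduction must be carried
-- through these weakenings.
⟶-rename : ∀ (ρ : Sub Fin m m′) (σ : Sub Fin n n′) {M M′} → M ⟶ M′ → rename ρ σ M ⟶ rename ρ σ M′
⟶-rename ρ σ (ϱ s)     = ϱ (ϱ-root-rename ρ σ s)
⟶-rename ρ σ (F.ρ s)   = F.ρ (ρ-root-rename ρ σ s)
⟶-rename ρ σ (ξ-ƛ s)   = ξ-ƛ (⟶-rename ρ (σ V.↑) s)
⟶-rename ρ σ (ξ-·ˡ s)  = ξ-·ˡ (⟶-rename ρ σ s)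
⟶-rename ρ σ (ξ-·ʳ s)  = ξ-·ʳ (⟶-rename ρ σ s)
⟶-rename ρ σ (ξ-⟨⟩ˡ s) = ξ-⟨⟩ˡ (⟶-rename ρ σ s)
⟶-rename ρ σ (ξ-⟨⟩ʳ s) = ξ-⟨⟩ʳ (⟶-rename ρ σ s)
⟶-rename ρ σ (ξ-·₁ s)  = ξ-·₁ (⟶-rename ρ σ s)
⟶-rename ρ σ (ξ-·₂ s)  = ξ-·₂ (⟶-rename ρ σ s)
⟶-rename ρ σ (ξ-Λ s)   = ξ-Λ (⟶-rename (ρ V.↑) σ s)
⟶-rename ρ σ (ξ-·ᵗ s)  = ξ-·ᵗ (⟶-rename ρ σ s)

fine-rename : ∀ {ρ : Sub Fin m m′} {σ : Sub Fin n n′} {Γ Γ′ M M′} → Renames ρ σ Γ Γ′ →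
  Γ ⊢ M ⟶ M′ fine → Γ′ ⊢ rename ρ σ M ⟶ rename ρ σ M′ fine
fine-rename {ρ = ρ} {σ} r (ϱ {M} {A} {B} t s) =
  ϱ {A = A /Var ρ} {B /Var ρ} (subst (_⊢_∶_ _ (rename ρ σ M)) (⊻-/Var A B) (⊢-rename r t))
    (ϱ-root-rename ρ σ s)
fine-rename {ρ = ρ} {σ} r (F.ρ t s) = F.ρ (⊢-rename r t) (ρ-root-rename ρ σ s)
fine-rename r (ξ-ƛ s)   = ξ-ƛ (fine-rename (Renames-∷ r _) s)
fine-rename r (ξ-·ˡ s)  = ξ-·ˡ (fine-rename r s)
fine-rename r (ξ-·ʳ s)  = ξ-·ʳ (fine-rename r s)
fine-rename r (ξ-⟨⟩ˡ s) = ξ-⟨⟩ˡ (fine-rename r s)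
fine-rename r (ξ-⟨⟩ʳ s) = ξ-⟨⟩ʳ (fine-rename r s)
fine-rename r (ξ-·₁ s)  = ξ-·₁ (fine-rename r s)
fine-rename r (ξ-·₂ s)  = ξ-·₂ (fine-rename r s)
fine-rename r (ξ-Λ s)   = ξ-Λ (fine-rename (Renames-⇑ᶜ r) s)
fine-rename r (ξ-·ᵗ s)  = ξ-·ᵗ (fine-rename r s)

-- Each clause of `case̲` is the corresponding ϱ contractum with its inner redexes unfolded in turn,
-- at smaller types.
case-⟶* : ∀ {M : Tm m n} {A B P Q} C → M ·ᵗ C · ⟨ ƛ A P , ƛ B Q ⟩ ⟶* case̲ M A P B Q C
case-⟶* (var X)   = ε
case-⟶* (C ⊃ D)   = ϱ ϱ-⊃ ◅ gmap (ƛ C) ξ-ƛ (case-⟶* D)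
case-⟶* (C₁ ∧ C₂) =
  ϱ ϱ-∧ ◅ gmap ⟨_, _ ⟩ ξ-⟨⟩ˡ (case-⟶* C₁) ◅◅ gmap ⟨ _ ,_⟩ ξ-⟨⟩ʳ (case-⟶* C₂)
case-⟶* (∀̇ C)     = ϱ ϱ-∀ ◅ gmap Λ ξ-Λ (case-⟶* C)

abort-⟶* : ∀ {M : Tm m n} A → M ·ᵗ A ⟶* abort̲ M A
abort-⟶* (var X) = ε
abort-⟶* (A ⊃ B) = F.ρ ρ-⊃ ◅ gmap (ƛ A) ξ-ƛ (abort-⟶* B)
abort-⟶* (A ∧ B) =
  F.ρ ρ-∧ ◅ gmap ⟨_, _ ⟩ ξ-⟨⟩ˡ (abort-⟶* A) ◅◅ gmap ⟨ _ ,_⟩ ξ-⟨⟩ʳ (abort-⟶* B)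
abort-⟶* (∀̇ A)   = F.ρ ρ-∀ ◅ gmap Λ ξ-Λ (abort-⟶* A)

case-fine* : ∀ {Γ : Ctx m n} {M A B P Q} C → Γ ⊢ M ∶ A ⊻ B →
             Γ ⊢ M ·ᵗ C · ⟨ ƛ A P , ƛ B Q ⟩ ⟶* case̲ M A P B Q C fine
case-fine* (var X) t = ε
case-fine* {A = A} {B} (C ⊃ D) t =
  ϱ {A = A} {B} t ϱ-⊃ ◅ gmap (ƛ C) ξ-ƛ (case-fine* {A = A} {B} D (⊢-⇑ t))
case-fine* {A = A} {B} (C₁ ∧ C₂) t =
  ϱ {A = A} {B} t ϱ-∧ ◅
    gmap ⟨_, _ ⟩ ξ-⟨⟩ˡ (case-fine* {A = A} {B} C₁ t) ◅◅ gmap ⟨ _ ,_⟩ ξ-⟨⟩ʳ (case-fine* {A = A} {B} C₂ t)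
case-fine* {A = A} {B} (∀̇ C) t =
  ϱ {A = A} {B} t ϱ-∀ ◅
    gmap Λ ξ-Λ (case-fine* {A = weaken A} {weaken B} C (⊢-⊻ᵗ {A = A} {B} t))

abort-fine* : ∀ {Γ : Ctx m n} {M} A → Γ ⊢ M ∶ ⊥̲ → Γ ⊢ M ·ᵗ A ⟶* abort̲ M A fine
abort-fine* (var X) t = ε
abort-fine* (A ⊃ B) t = F.ρ t ρ-⊃ ◅ gmap (ƛ A) ξ-ƛ (abort-fine* B (⊢-⇑ t))
abort-fine* (A ∧ B) t =
  F.ρ t ρ-∧ ◅ gmap ⟨_, _ ⟩ ξ-⟨⟩ˡ (abort-fine* A t) ◅◅ gmap ⟨ _ ,_⟩ ξ-⟨⟩ʳ (abort-fine* B t)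
abort-fine* (∀̇ A)   t = F.ρ t ρ-∀ ◅ gmap Λ ξ-Λ (abort-fine* A (⊢-⇑ᵗ t))

•-⟶*-° : (M : IPC.Tm m n) → M • ⟶* M °
•-⟶*-° (IPC.` x) = ε
•-⟶*-° (IPC.ƛ A M) = gmap (ƛ _) ξ-ƛ (•-⟶*-° M)
•-⟶*-° (M IPC.· N) = gmap (_· _) ξ-·ˡ (•-⟶*-° M) ◅◅ gmap (_ ·_) ξ-·ʳ (•-⟶*-° N)
•-⟶*-° IPC.⟨ M , N ⟩ = gmap ⟨_, _ ⟩ ξ-⟨⟩ˡ (•-⟶*-° M) ◅◅ gmap ⟨ _ ,_⟩ ξ-⟨⟩ʳ (•-⟶*-° N)
•-⟶*-° (M IPC.·₁) = gmap _·₁ ξ-·₁ (•-⟶*-° M)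
•-⟶*-° (M IPC.·₂) = gmap _·₂ ξ-·₂ (•-⟶*-° M)
•-⟶*-° (IPC.in₁ M A B) =
  gmap (λ N → Λ (ƛ _ ((` zero) ·₁ · N ⇑ᵗ ⇑)))
       (λ s → ξ-Λ (ξ-ƛ (ξ-·ʳ (⟶-rename V.id V.wk (⟶-rename V.wk V.id s))))) (•-⟶*-° M)
•-⟶*-° (IPC.in₂ M A B) =
  gmap (λ N → Λ (ƛ _ ((` zero) ·₂ · N ⇑ᵗ ⇑)))
       (λ s → ξ-Λ (ξ-ƛ (ξ-·ʳ (⟶-rename V.id V.wk (⟶-rename V.wk V.id s))))) (•-⟶*-° M)
•-⟶*-° (IPC.case M A P B Q C) =
  -- Reducing the subterms while each still occurs once avoids tracking the weakened copies that the
  -- unfolding makes of them.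
  gmap (λ M → M ·ᵗ _ · _) (λ s → ξ-·ˡ (ξ-·ᵗ s)) (•-⟶*-° M) ◅◅
  gmap (λ P → _ · ⟨ ƛ _ P , _ ⟩) (λ s → ξ-·ʳ (ξ-⟨⟩ˡ (ξ-ƛ s))) (•-⟶*-° P) ◅◅
  gmap (λ Q → _ · ⟨ _ , ƛ _ Q ⟩) (λ s → ξ-·ʳ (ξ-⟨⟩ʳ (ξ-ƛ s))) (•-⟶*-° Q) ◅◅
  case-⟶* (C •ᵗ)
•-⟶*-° (IPC.abort M A) = gmap (_·ᵗ _) ξ-·ᵗ (•-⟶*-° M) ◅◅ abort-⟶* (A •ᵗ)

⊢-• : ∀ {Γ : IPC.Ctx m n} {M A} → Γ IPC.⊢ M ∶ A → Γ •ᶜ ⊢ M • ∶ A •ᵗ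
⊢-• {Γ = Γ} (IPC.ax x) = subst (_ ⊢ _ ∶_) (lookup-map x _•ᵗ Γ) (ax x)
⊢-• (IPC.⊃I t) = ⊃I (⊢-• t)
⊢-• (IPC.⊃E t u) = ⊃E (⊢-• t) (⊢-• u)
⊢-• (IPC.∧I t u) = ∧I (⊢-• t) (⊢-• u)
⊢-• (IPC.∧E₁ t) = ∧E₁ (⊢-• t)
⊢-• (IPC.∧E₂ t) = ∧E₂ (⊢-• t)
⊢-• (IPC.∨I₁ t) = ∀I (⊃I (⊃E (∧E₁ (ax zero)) (⊢-⇑ (⊢-⇑ᵗ (⊢-• t)))))
⊢-• (IPC.∨I₂ t) = ∀I (⊃I (⊃E (∧E₂ (ax zero)) (⊢-⇑ (⊢-⇑ᵗ (⊢-• t)))))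
⊢-• (IPC.∨E {A} {B} t p q) = ⊢-case {A = A •ᵗ} {B •ᵗ} (⊢-• t) (⊢-• p) (⊢-• q)
⊢-• (IPC.⊥E {A} t) = ∀E (A •ᵗ) (⊢-• t)

•-fine*-° : ∀ {Γ : IPC.Ctx m n} {M A} → Γ IPC.⊢ M ∶ A → Γ •ᶜ ⊢ M • ⟶* M ° fine
•-fine*-° (IPC.ax x) = ε
•-fine*-° (IPC.⊃I t) = gmap (ƛ _) ξ-ƛ (•-fine*-° t)
•-fine*-° (IPC.⊃E t u) = gmap (_· _) ξ-·ˡ (•-fine*-° t) ◅◅ gmap (_ ·_) ξ-·ʳ (•-fine*-° u)
•-fine*-° (IPC.∧I t u) = gmap ⟨_, _ ⟩ ξ-⟨⟩ˡ (•-fine*-° t) ◅◅ gmap ⟨ _ ,_⟩ ξ-⟨⟩ʳ (•-fine*-° u)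
•-fine*-° (IPC.∧E₁ t) = gmap _·₁ ξ-·₁ (•-fine*-° t)
•-fine*-° (IPC.∧E₂ t) = gmap _·₂ ξ-·₂ (•-fine*-° t)
•-fine*-° (IPC.∨I₁ t) =
  gmap (λ N → Λ (ƛ _ ((` zero) ·₁ · N ⇑ᵗ ⇑)))
       (λ s → ξ-Λ (ξ-ƛ (ξ-·ʳ (fine-rename Renames-wk (fine-rename Renames-wkᵗ s))))) (•-fine*-° t)
•-fine*-° (IPC.∨I₂ t) =
  gmap (λ N → Λ (ƛ _ ((` zero) ·₂ · N ⇑ᵗ ⇑)))
       (λ s → ξ-Λ (ξ-ƛ (ξ-·ʳ (fine-rename Renames-wk (fine-rename Renames-wkᵗ s))))) (•-fine*-° t)
•-fine*-° (IPC.∨E {A} {B} {C} t p q) =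
  gmap (λ M → M ·ᵗ _ · _) (λ s → ξ-·ˡ (ξ-·ᵗ s)) (•-fine*-° t) ◅◅
  gmap (λ P → _ · ⟨ ƛ _ P , _ ⟩) (λ s → ξ-·ʳ (ξ-⟨⟩ˡ (ξ-ƛ s))) (•-fine*-° p) ◅◅
  gmap (λ Q → _ · ⟨ _ , ƛ _ Q ⟩) (λ s → ξ-·ʳ (ξ-⟨⟩ʳ (ξ-ƛ s))) (•-fine*-° q) ◅◅
  case-fine* {A = A •ᵗ} {B •ᵗ} (C •ᵗ) (fine*-preserves (•-fine*-° t) (⊢-• t))
•-fine*-° (IPC.⊥E {A} t) =
  gmap (_·ᵗ _) ξ-·ᵗ (•-fine*-° t) ◅◅ abort-fine* (A •ᵗ) (fine*-preserves (•-fine*-° t) (⊢-• t))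

-- The terms of F_at.
data Atomic {m n} : Tm m n → Set where
  `_    : ∀ x → Atomic (` x)
  ƛ     : ∀ {A M} → Atomic M → Atomic (ƛ A M)
  _·_   : ∀ {M N} → Atomic M → Atomic N → Atomic (M · N)
  ⟨_,_⟩ : ∀ {M N} → Atomic M → Atomic N → Atomic ⟨ M , N ⟩
  _·₁   : ∀ {M} → Atomic M → Atomic (M ·₁)
  _·₂   : ∀ {M} → Atomic M → Atomic (M ·₂)
  Λ     : ∀ {M} → Atomic M → Atomic (Λ M)
  _·ᵗ_  : ∀ {M} → Atomic M → ∀ X → Atomic (M ·ᵗ var X)

Atomic-rename : ∀ (ρ : Sub Fin m m′) (σ : Sub Fin n n′) {M} → Atomic M → Atomic (rename ρ σ M)
Atomic-rename ρ σ (` x)     = ` lookup σ x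
Atomic-rename ρ σ (ƛ a)     = ƛ (Atomic-rename ρ (σ V.↑) a)
Atomic-rename ρ σ (a · b)   = Atomic-rename ρ σ a · Atomic-rename ρ σ b
Atomic-rename ρ σ ⟨ a , b ⟩ = ⟨ Atomic-rename ρ σ a , Atomic-rename ρ σ b ⟩
Atomic-rename ρ σ (a ·₁)    = Atomic-rename ρ σ a ·₁
Atomic-rename ρ σ (a ·₂)    = Atomic-rename ρ σ a ·₂
Atomic-rename ρ σ (Λ a)     = Λ (Atomic-rename (ρ V.↑) σ a)
Atomic-rename ρ σ (a ·ᵗ X)  = Atomic-rename ρ σ a ·ᵗ lookup ρ X

-- The only instantiations added are at `X` in the variable clause and at `var zero` when a branch
-- is expanded.
Atomic-case̲ : ∀ {M : Tm m n} {A B P Q} → Atomic M → Atomic P → Atomic Q → ∀ C → Atomic (case̲ M A P B Q C)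
Atomic-case̲ a p q (var X)   = a ·ᵗ X · ⟨ ƛ p , ƛ q ⟩
Atomic-case̲ a p q (C ⊃ D)   = ƛ (Atomic-case̲ (Atomic-rename _ _ a)
  (Atomic-rename _ _ p · ` suc zero) (Atomic-rename _ _ q · ` suc zero) D)
Atomic-case̲ a p q (C₁ ∧ C₂) = ⟨ Atomic-case̲ a (p ·₁) (q ·₁) C₁ , Atomic-case̲ a (p ·₂) (q ·₂) C₂ ⟩
Atomic-case̲ a p q (∀̇ C)     = Λ (Atomic-case̲ (Atomic-rename _ _ a)
  (Atomic-rename _ _ p ·ᵗ zero) (Atomic-rename _ _ q ·ᵗ zero) C)

Atomic-abort̲ : ∀ {M : Tm m n} → Atomic M → ∀ A → Atomic (abort̲ M A)
Atomic-abort̲ a (var X) = a ·ᵗ X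
Atomic-abort̲ a (A ⊃ B) = ƛ (Atomic-abort̲ (Atomic-rename _ _ a) B)
Atomic-abort̲ a (A ∧ B) = ⟨ Atomic-abort̲ a A , Atomic-abort̲ a B ⟩
Atomic-abort̲ a (∀̇ A)   = Λ (Atomic-abort̲ (Atomic-rename _ _ a) A)

Atomic-° : (M : IPC.Tm m n) → Atomic (M °)
Atomic-° (IPC.` x)              = ` x
Atomic-° (IPC.ƛ A M)            = ƛ (Atomic-° M)
Atomic-° (M IPC.· N)            = Atomic-° M · Atomic-° N
Atomic-° IPC.⟨ M , N ⟩          = ⟨ Atomic-° M , Atomic-° N ⟩
Atomic-° (M IPC.·₁)             = Atomic-° M ·₁
Atomic-° (M IPC.·₂)             = Atomic-° M ·₂
Atomic-° (IPC.in₁ M A B)        = Λ (ƛ ((` zero) ·₁ · Atomic-rename _ _ (Atomic-rename _ _ (Atomic-° M))))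
Atomic-° (IPC.in₂ M A B)        = Λ (ƛ ((` zero) ·₂ · Atomic-rename _ _ (Atomic-rename _ _ (Atomic-° M))))
Atomic-° (IPC.case M A P B Q C) = Atomic-case̲ (Atomic-° M) (Atomic-° P) (Atomic-° Q) (C •ᵗ)
Atomic-° (IPC.abort M A)        = Atomic-abort̲ (Atomic-° M) (A •ᵗ)

Atomic⇒¬ϱ : ∀ {M : Tm m n} {A B N N′} → Atomic N → ¬ ϱ-root M A B N N′
Atomic⇒¬ϱ (() · _) ϱ-⊃
Atomic⇒¬ϱ (() · _) ϱ-∧
Atomic⇒¬ϱ (() · _) ϱ-∀

Atomic⇒¬ρ : ∀ {M N N′ : Tm m n} → Atomic N → ¬ ρ-root M N N′
Atomic⇒¬ρ () ρ-⊃
Atomic⇒¬ρ () ρ-∧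
Atomic⇒¬ρ () ρ-∀

Atomic⇒FineNormal : ∀ {Γ : Ctx m n} {M} → Atomic M → FineNormal Γ M
Atomic⇒FineNormal a         _ (ϱ _ s)   = Atomic⇒¬ϱ a s
Atomic⇒FineNormal a         _ (F.ρ _ s) = Atomic⇒¬ρ a s
Atomic⇒FineNormal (ƛ a)     _ (ξ-ƛ s)   = Atomic⇒FineNormal a _ s
Atomic⇒FineNormal (a · b)   _ (ξ-·ˡ s)  = Atomic⇒FineNormal a _ s
Atomic⇒FineNormal (a · b)   _ (ξ-·ʳ s)  = Atomic⇒FineNormal b _ s
Atomic⇒FineNormal ⟨ a , b ⟩ _ (ξ-⟨⟩ˡ s) = Atomic⇒FineNormal a _ s
Atomic⇒FineNormal ⟨ a , b ⟩ _ (ξ-⟨⟩ʳ s) = Atomic⇒FineNormal b _ s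
Atomic⇒FineNormal (a ·₁)    _ (ξ-·₁ s)  = Atomic⇒FineNormal a _ s
Atomic⇒FineNormal (a ·₂)    _ (ξ-·₂ s)  = Atomic⇒FineNormal a _ s
Atomic⇒FineNormal (Λ a)     _ (ξ-Λ s)   = Atomic⇒FineNormal a _ s
Atomic⇒FineNormal (a ·ᵗ X)  _ (ξ-·ᵗ s)  = Atomic⇒FineNormal a _ s

-- Uniqueness of the fine normal form, and the theorem

fineNormalForm-unique : ∀ {Γ : Ctx m n} {M A N N′} → Γ ⊢ M ∶ A →
  IsFineNormalFormOf Γ M N → IsFineNormalFormOf Γ M N′ → N′ ≡ N
fineNormalForm-unique {Γ = Γ} {M} {N = N} {N′} t (ss , normal) (ss′ , normal′) = begin
  N′      ≡⟨ nf-normal (fine*-preserves ss′ t) normal′ ⟨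
  nf Γ N′ ≡⟨ nf-fine* ss′ ⟨
  nf Γ M  ≡⟨ nf-fine* ss ⟩
  nf Γ N  ≡⟨ nf-normal (fine*-preserves ss t) normal ⟩
  N       ∎
  where open ≡-Reasoning

proposition8 : (m n : ℕ) (M : IPC.Tm m n) →
    (M • F.⟶* M °) ×
    ((Γ : IPC.Ctx m n) → IPC.Typable Γ M →
    (Γ •ᶜ F.⊢ M • ⟶* M ° fine) × F.IsAtomicNormalFormOf (Γ •ᶜ) (M •) (M °))
proposition8 m n M = •-⟶*-° M , λ Γ (A , t) →
  let normalForm = •-fine*-° t , Atomic⇒FineNormal (Atomic-° M)
  in •-fine*-° t , normalForm , λ N′ → fineNormalForm-unique (⊢-• t) normalForm
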